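{- Let $s,t$ be integers with $2\le s\le t-2$ and $t\ge 34$. Then $R^4(BK_t,BK_s)=t$.
   Context: For a graph $G=(V,E)$ and an integer $r\ge 2$, $BG$ (the set of Berge copies of $G$) is the set of $r$-uniform hypergraphs $\mathcal{H}'$ for which there exist an injection $\phi: V\to V(\mathcal{H}')$ and a bijection $\psi: E\to E(\mathcal{H}')$ such that $\{\phi(u),\phi(v)\}\subseteq \psi(uv)$ for every edge $uv\in E$. $K_n$ denotes the complete graph on $n$ vertices. For collections $\mathcal{F}_1,\mathcal{F}_2$ of $r$-uniform hypergraphs, $R^r(\mathcal{F}_1,\mathcal{F}_2)$ is the least $N$ such that every 2-coloring of the hyperedges of the complete $r$-uniform hypergraph on $N$ vertices contains a subhypergraph of the first color isomorphic to a member of $\mathcal{F}_1$ or one of the second color isomorphic to a member of $\mathcal{F}_2$. Here $r=4$. -}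

module Defs where

open import Data.Nat using (ℕ; _<_)
open import Data.Bool using (Bool; true; false)
open import Data.Fin as Fin using (Fin)
open import Data.Fin.Subset using (Subset; _∈_; ∣_∣)
open import Data.Product using (Σ; _×_)
open import Data.Sum using (_⊎_)
open import Relation.Nullary using (¬_)
open import Relation.Binary.PropositionalEquality using (_≡_)
open import Function.Definitions using (Injective)

-- The complete r-uniform hypergraph on N vertices: vertex set Fin N,
-- hyperedges = subsets of Fin N of size r.
-- A 2-colouring of its hyperedges: a function Subset N → Bool
-- (only its values on r-element subsets matter). Colour 1 = true, colour 2 = false.
Colouring : ℕ → Set
Colouring N = Subset N → Bool

HasBergeK : (r N : ℕ) → Colouring N → Bool → ℕ → Set
HasBergeK r N c col k =
  Σ (Fin k → Fin N) λ φ →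
    Injective _≡_ _≡_ φ ×
    Σ (Fin k → Fin k → Subset N) λ ψ →
      (∀ u v → u Fin.< v →
         (∣ ψ u v ∣ ≡ r) × (c (ψ u v) ≡ col) × (φ u ∈ ψ u v) × (φ v ∈ ψ u v)) ×
      (∀ u v u′ v′ → u Fin.< v → u′ Fin.< v′ →
         ψ u v ≡ ψ u′ v′ → (u ≡ u′) × (v ≡ v′))

Arrows : (r N t s : ℕ) → Set
Arrows r N t s = (c : Colouring N) → HasBergeK r N c true t ⊎ HasBergeK r N c false s

RamseyBergeEq : (r t s n : ℕ) → Set
RamseyBergeEq r t s n = Arrows r n t s × (∀ N → N < n → ¬ Arrows r N t s)

{-# OPTIONS --safe #-}
module Submission where

open import Defs
open import Data.Nat using (ℕ; zero; suc; _+_; _*_; _≤_; _<_; _<?_; _≤?_; z≤n; s≤s; s≤s⁻¹; >-nonZero)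
open import Data.Nat.Properties
open import Data.Bool using (Bool; true; false)
import Data.Bool.Properties as Bool
open import Data.Fin as Fin using (Fin; zero; suc)
import Data.Fin.Properties as Fin
open import Data.Fin.Subset using (Subset; ∣_∣; ⁅_⁆; _∪_; ⊥; _⊆_) renaming (_∈_ to _∈ˢ_; _∉_ to _∉ˢ_)
import Data.Fin.Subset.Properties as Sub
open import Data.Vec using ([]; _∷_; here; there)
import Data.Vec.Properties as Vec
open import Data.List using (List; []; _∷_; [_]; _++_; map; length; filter; allFin; cartesianProduct)
open import Data.List.Properties using (length-map; length-tabulate)
open import Data.List.Membership.Propositional using (_∈_; _∉_; find; lose)
open import Data.List.Membership.Propositional.Properties using (∈-map⁺; ∈-map⁻; ∈-++⁺ˡ; ∈-++⁺ʳ; ∈-++⁻; ∈-∃++; ∈-filter⁻; ∈-filter⁺; ∈-allFin; ∈-cartesianProduct⁺)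
open import Data.List.Relation.Unary.Any using (Any; here; there; any?)
open import Data.List.Relation.Unary.All as All using (All; []; _∷_)
open import Data.List.Relation.Unary.AllPairs using ([]; _∷_)
open import Data.List.Relation.Unary.Unique.Propositional using (Unique)
open import Data.List.Relation.Unary.Unique.Propositional.Properties using (Unique[x∷xs]⇒x∉xs; allFin⁺; filter⁺; cartesianProduct⁺) renaming (map⁺ to Unique-map⁺; ++⁺ to Unique-++⁺)
open import Data.List.Relation.Binary.Permutation.Propositional as Perm using (_↭_; ↭-refl; ↭-sym; ↭-trans; prep; swap)
open import Data.List.Relation.Binary.Permutation.Propositional.Properties using (∈-resp-↭; ↭-length; shift; ++⁺ˡ)
open import Data.Product using (Σ; ∃; _×_; _,_; proj₁; proj₂)
open import Data.Product.Properties using (≡-dec)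
open import Data.Sum using (_⊎_; inj₁; inj₂)
open import Data.Empty using (⊥-elim) renaming (⊥ to Empty)
open import Function using (_∘_; id)
open import Relation.Nullary using (¬_; Dec; yes; no; ¬?; contradiction)
open import Relation.Nullary.Decidable using (_×-dec_; _⊎-dec_; decidable-stable; map′)
open import Relation.Unary using (Decidable)
open import Relation.Binary using (DecidableEquality; tri<; tri≈; tri>)
open import Relation.Binary.PropositionalEquality using (_≡_; _≢_; refl; sym; trans; cong; cong₂; subst; subst₂; module ≡-Reasoning)

-- Colour true is red, colour false is blue.  Call a pair of vertices low in a colour if at most
-- five 4-sets of that colour contain it.  For t ≥ 14 a blue-low pair never meets a red-low pair,
-- since both colours would then be rare among the t − 3 quadruples through some three vertices.
-- Representatives are found fractionally: if weights between pairs and hyperedges give every pair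
-- at least W and every hyperedge at most W, then a system of distinct representatives exists.
--
-- If some z ≠ z′ are such that every blue-low pair f outside {z , z′} has f ∪ {z , z′} blue, there
-- is a blue Berge clique on the complement of {z , z′}: weight 6 for hyperedges containing z and
-- z′, and weight 1 for all others, with W = 6.
--
-- Otherwise every pair p has a blue-low pair g disjoint from it with p ∪ g red; in particular there
-- are two disjoint blue-low pairs a₀b₀ and a₁b₁.  Every red-low pair p is then served by the "special"
-- hyperedges p ∪ g with g blue-low: half of each of a₀b₀p and a₁b₁p if both are red, and one
-- full hyperedge in the at most ten remaining cases.  What is left of the red hyperedges is
-- enough for the pairs that are not red-low.

-- Finite sums and counting

∑ : {A : Set} → List A → (A → ℕ) → ℕ
∑ []       f = 0
∑ (x ∷ xs) f = f x + ∑ xs f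

module _ {A : Set} where

  ∑-mono : ∀ (xs : List A) {f g} → (∀ {x} → x ∈ xs → f x ≤ g x) → ∑ xs f ≤ ∑ xs g
  ∑-mono []       f≤g = z≤n
  ∑-mono (x ∷ xs) f≤g = +-mono-≤ (f≤g (here refl)) (∑-mono xs (f≤g ∘ there))

  ∑-const : ∀ (xs : List A) k → ∑ xs (λ _ → k) ≡ length xs * k
  ∑-const []       k = refl
  ∑-const (x ∷ xs) k = cong (k +_) (∑-const xs k)

  ∑-+ : ∀ (xs : List A) f g → ∑ xs (λ x → f x + g x) ≡ ∑ xs f + ∑ xs g
  ∑-+ []       f g = refl
  ∑-+ (x ∷ xs) f g = begin
    f x + g x + ∑ xs (λ y → f y + g y) ≡⟨ cong (f x + g x +_) (∑-+ xs f g) ⟩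
    f x + g x + (∑ xs f + ∑ xs g)      ≡⟨ +-assoc (f x) (g x) _ ⟩
    f x + (g x + (∑ xs f + ∑ xs g))    ≡⟨ cong (f x +_) (+-assoc (g x) _ _) ⟨
    f x + (g x + ∑ xs f + ∑ xs g)      ≡⟨ cong (λ z → f x + (z + ∑ xs g)) (+-comm (g x) _) ⟩
    f x + (∑ xs f + g x + ∑ xs g)      ≡⟨ cong (f x +_) (+-assoc (∑ xs f) _ _) ⟩
    f x + (∑ xs f + (g x + ∑ xs g))    ≡⟨ +-assoc (f x) _ _ ⟨
    f x + ∑ xs f + (g x + ∑ xs g)      ∎
    where open ≡-Reasoning

  ∑-* : ∀ (xs : List A) k f → ∑ xs (λ x → k * f x) ≡ k * ∑ xs f
  ∑-* []       k f = sym (*-zeroʳ k)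
  ∑-* (x ∷ xs) k f = trans (cong (k * f x +_) (∑-* xs k f)) (sym (*-distribˡ-+ k (f x) _))

  ∑-++ : ∀ (xs ys : List A) f → ∑ (xs ++ ys) f ≡ ∑ xs f + ∑ ys f
  ∑-++ []       ys f = refl
  ∑-++ (x ∷ xs) ys f = trans (cong (f x +_) (∑-++ xs ys f)) (sym (+-assoc (f x) _ _))

  ∑-↭ : ∀ {xs ys : List A} f → xs ↭ ys → ∑ xs f ≡ ∑ ys f
  ∑-↭ f Perm.refl = refl
  ∑-↭ f (Perm.prep x p) = cong (f x +_) (∑-↭ f p)
  ∑-↭ f (Perm.swap {xs} {ys} x y p) = begin
    f x + (f y + ∑ xs f) ≡⟨ +-assoc (f x) (f y) _ ⟨
    f x + f y + ∑ xs f   ≡⟨ cong₂ _+_ (+-comm (f x) (f y)) (∑-↭ f p) ⟩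
    f y + f x + ∑ ys f   ≡⟨ +-assoc (f y) (f x) _ ⟩
    f y + (f x + ∑ ys f) ∎
    where open ≡-Reasoning
  ∑-↭ f (Perm.trans p q) = trans (∑-↭ f p) (∑-↭ f q)

  ∈⇒≤∑ : ∀ {xs : List A} {x} f → x ∈ xs → f x ≤ ∑ xs f
  ∈⇒≤∑ f (here refl) = m≤m+n _ _
  ∈⇒≤∑ f (there {x = y} x∈xs) = ≤-trans (∈⇒≤∑ f x∈xs) (m≤n+m _ (f y))

  -- Each entry of `xs` with a positive value uses up one occurrence in `zs`; as `xs` has no
  -- repetitions, later entries never need that occurrence again.
  ∑-support-≤ : ∀ {xs} (zs : List A) f → Unique xs →
                (∀ {x} → x ∈ xs → 0 < f x → x ∈ zs) → ∑ xs f ≤ ∑ zs f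
  ∑-support-≤ {[]}     zs f _ supp = z≤n
  ∑-support-≤ {x ∷ xs} zs f (x∉ ∷ uniq) supp with 0 <? f x
  ... | no  fx≯0 = subst (_≤ ∑ zs f) (cong (_+ ∑ xs f) (sym (n≤0⇒n≡0 (≮⇒≥ fx≯0))))
                     (∑-support-≤ zs f uniq (supp ∘ there))
  ... | yes fx>0 with us , vs , refl ← ∈-∃++ (supp (here refl) fx>0) = begin
      f x + ∑ xs f         ≤⟨ +-monoʳ-≤ (f x) (∑-support-≤ (us ++ vs) f uniq supp′) ⟩
      f x + ∑ (us ++ vs) f ≡⟨ ∑-↭ f (shift x us vs) ⟨
      ∑ (us ++ x ∷ vs) f   ∎
    where
    open ≤-Reasoning
    supp′ : ∀ {y} → y ∈ xs → 0 < f y → y ∈ us ++ vs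
    supp′ y∈xs fy>0 with ∈-resp-↭ (shift x us vs) (supp (there y∈xs) fy>0)
    ... | here y≡x = ⊥-elim (All.lookup x∉ y∈xs (sym y≡x))
    ... | there y∈ = y∈

  ∑-at-most-one : ∀ {xs : List A} {f k} → Unique xs → (∀ x → f x ≤ k) →
                  (∀ {x y} → x ∈ xs → y ∈ xs → 0 < f x → 0 < f y → x ≡ y) → ∑ xs f ≤ k
  ∑-at-most-one {xs} {f} {k} uniq f≤k same with any? (λ x → 0 <? f x) xs
  ... | yes ∃x with x , x∈xs , fx>0 ← find ∃x =
      ≤-trans (∑-support-≤ [ x ] f uniq (λ y∈xs fy>0 → here (same y∈xs x∈xs fy>0 fx>0)))
              (subst (_≤ k) (sym (+-identityʳ (f x))) (f≤k x))
  ... | no  ∄x = ≤-trans (∑-support-≤ [] f uniq (λ x∈xs fx>0 → ⊥-elim (∄x (lose x∈xs fx>0)))) z≤n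

∑-swap : {A B : Set} (xs : List A) (ys : List B) (f : A → B → ℕ) →
         ∑ xs (λ x → ∑ ys (f x)) ≡ ∑ ys (λ y → ∑ xs (λ x → f x y))
∑-swap []       ys f = sym (trans (∑-const ys 0) (*-zeroʳ (length ys)))
∑-swap (x ∷ xs) ys f = trans (cong (∑ ys (f x) +_) (∑-swap xs ys f)) (sym (∑-+ ys (f x) _))

-- Each entry of `xs` adds at least 1 to the double sum. In the applications the functions are
-- indicators of possibly overlapping sets that cover all vertices, each paired with a bound on its
-- size.
union-bound : {A : Set} (xs : List A) (fs : List ((A → ℕ) × ℕ)) →
              All (λ (f , k) → ∑ xs f ≤ k) fs → (∀ x → Any (λ (f , _) → 0 < f x) fs) →
              length xs ≤ ∑ fs proj₂
union-bound xs fs bounds cover = begin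
  length xs                             ≡⟨ trans (∑-const xs 1) (*-identityʳ _) ⟨
  ∑ xs (λ _ → 1)                        ≤⟨ ∑-mono xs (λ {x} _ → covered x) ⟩
  ∑ xs (λ x → ∑ fs (λ (f , _) → f x))   ≡⟨ ∑-swap xs fs (λ x (f , _) → f x) ⟩
  ∑ fs (λ (f , _) → ∑ xs f)             ≤⟨ ∑-mono fs (All.lookup bounds) ⟩
  ∑ fs proj₂                            ∎
  where
  open ≤-Reasoning
  covered : ∀ x → 1 ≤ ∑ fs (λ (f , _) → f x)
  covered x with f , f∈ , pos ← find (cover x) = ≤-trans pos (∈⇒≤∑ (λ (f , _) → f x) f∈)

𝟙 : {P : Set} → Dec P → ℕ
𝟙 (yes _) = 1
𝟙 (no  _) = 0

𝟙-yes : {P : Set} (P? : Dec P) → P → 0 < 𝟙 P?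
𝟙-yes (yes _) p = ≤-refl
𝟙-yes (no ¬p) p = ⊥-elim (¬p p)

𝟙-pos : {P : Set} (P? : Dec P) → 0 < 𝟙 P? → P
𝟙-pos (yes p) _ = p

𝟙≤1 : {P : Set} (P? : Dec P) → 𝟙 P? ≤ 1
𝟙≤1 (yes _) = ≤-refl
𝟙≤1 (no _)  = z≤n

-- The images of the counted elements are distinct entries of `ys`, each of value at least 1. This
-- turns counts of fourth vertices into degrees and weights of hyperedges.
∑𝟙-image-≤ : {A B : Set} {P : A → Set} (P? : Decidable P) {xs : List A} (h : A → B)
             (ys : List B) (f : B → ℕ) → Unique xs →
             (∀ {x y} → P x → P y → h x ≡ h y → x ≡ y) →
             (∀ {x} → P x → h x ∈ ys × 0 < f (h x)) →
             ∑ xs (λ x → 𝟙 (P? x)) ≤ ∑ ys f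
∑𝟙-image-≤ {A} {B} {P} P? {xs} h ys f uniq inj good =
  ≤-trans (below xs) (∑-support-≤ ys f (images-unique uniq) λ y∈ _ → image∈ys y∈)
  where
  images : List A → List B
  images []       = []
  images (x ∷ xs) with P? x
  ... | yes _ = h x ∷ images xs
  ... | no  _ = images xs

  ∈-images : ∀ {y} xs → y ∈ images xs → ∃ λ x → x ∈ xs × P x × y ≡ h x
  ∈-images (x ∷ xs) y∈ with P? x
  ∈-images (x ∷ xs) (here eq)  | yes px = x , here refl , px , eq
  ∈-images (x ∷ xs) (there y∈) | yes px with z , z∈ , pz , eq ← ∈-images xs y∈ = z , there z∈ , pz , eq
  ∈-images (x ∷ xs) y∈         | no _   with z , z∈ , pz , eq ← ∈-images xs y∈ = z , there z∈ , pz , eq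

  image∈ys : ∀ {y} → y ∈ images xs → y ∈ ys
  image∈ys y∈ with z , _ , pz , refl ← ∈-images xs y∈ = proj₁ (good pz)

  images-unique : ∀ {xs} → Unique xs → Unique (images xs)
  images-unique {[]} _ = []
  images-unique {x ∷ xs} (x∉ ∷ uniq) with P? x
  ... | no  _  = images-unique uniq
  ... | yes px = All.tabulate fresh ∷ images-unique uniq
    where
    fresh : ∀ {y} → y ∈ images xs → h x ≢ y
    fresh y∈ hx≡y with z , z∈ , pz , refl ← ∈-images xs y∈ = All.lookup x∉ z∈ (inj px pz hx≡y)

  below : ∀ xs → ∑ xs (λ x → 𝟙 (P? x)) ≤ ∑ (images xs) f
  below []       = z≤n
  below (x ∷ xs) with P? x
  ... | yes px = +-mono-≤ (proj₂ (good px)) (below xs)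
  ... | no  _  = below xs

-- Distinct representatives from fractional weights

module WeightedMatching {A B : Set} (_≟ᴬ_ : DecidableEquality A) (_≟ᴮ_ : DecidableEquality B)
  (ys : List B) (ys-unique : Unique ys) (w : A → B → ℕ) (W : ℕ) (W>0 : 0 < W) where

  open import Data.List.Membership.DecPropositional _≟ᴮ_ using (_∈?_)

  Matching : List A → (A → B) → Set
  Matching xs f = (∀ {a} → a ∈ xs → 0 < w a (f a)) ×
                  (∀ {a a′} → a ∈ xs → a′ ∈ xs → f a ≡ f a′ → a ≡ a′)

  _[_≔_] : (A → B) → A → B → A → B
  (f [ x ≔ b ]) a with a ≟ᴬ x
  ... | yes _ = b
  ... | no  _ = f a

  ≔-other : ∀ f {x a} b → a ≢ x → (f [ x ≔ b ]) a ≡ f a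
  ≔-other f {x} {a} b a≢x with a ≟ᴬ x
  ... | yes a≡x = contradiction a≡x a≢x
  ... | no  _   = refl

  module Augment {x : A} {xs : List A} (x∉xs : x ∉ xs) (f : A → B) (f-matching : Matching xs f)
    (rows : ∀ {a} → a ∈ x ∷ xs → W ≤ ∑ ys (w a))
    (cols : ∀ b → ∑ (x ∷ xs) (λ a → w a b) ≤ W) where

    -- f rerouted along an alternating path from x to ℓ inside x ∷ L, so that ℓ is the
    -- unmatched element instead of x.
    record Rerouted (L : List A) (ℓ : A) : Set where
      field
        h       : A → B
        h-pos   : ∀ {a} → a ∈ x ∷ xs → a ≢ ℓ → 0 < w a (h a)
        h-inj   : ∀ {a a′} → a ∈ x ∷ xs → a′ ∈ x ∷ xs → a ≢ ℓ → a′ ≢ ℓ → h a ≡ h a′ → a ≡ a′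
        h-image : ∀ {a} → a ∈ x ∷ xs → a ≢ ℓ → h a ∈ map f xs
        h-agree : ∀ {a} → a ∈ xs → a ∉ x ∷ L → h a ≡ f a

    start : Rerouted [] x
    start = record
      { h       = f
      ; h-pos   = λ a∈ a≢x → proj₁ f-matching (tail a∈ a≢x)
      ; h-inj   = λ a∈ a′∈ a≢x a′≢x → proj₂ f-matching (tail a∈ a≢x) (tail a′∈ a′≢x)
      ; h-image = λ a∈ a≢x → ∈-map⁺ f (tail a∈ a≢x)
      ; h-agree = λ _ _ → refl
      }
      where
      tail : ∀ {a} → a ∈ x ∷ xs → a ≢ x → a ∈ xs
      tail (here a≡x)  a≢x = contradiction a≡x a≢x
      tail (there a∈) _   = a∈

    -- Away from `ℓ`, `h` takes its values in the image of `f`, so the free `b` can be given to `ℓ`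
    -- without a collision: the alternating path is augmenting.
    finish : ∀ {L ℓ b} → Rerouted L ℓ → 0 < w ℓ b → b ∉ map f xs → ∃ (Matching (x ∷ xs))
    finish {L} {ℓ} {b} R pos b∉ = h [ ℓ ≔ b ] , pos′ , inj′
      where
      open Rerouted R
      pos′ : ∀ {a} → a ∈ x ∷ xs → 0 < w a ((h [ ℓ ≔ b ]) a)
      pos′ {a} a∈ with a ≟ᴬ ℓ
      ... | yes refl = pos
      ... | no a≢ℓ   = h-pos a∈ a≢ℓ
      inj′ : ∀ {a a′} → a ∈ x ∷ xs → a′ ∈ x ∷ xs → (h [ ℓ ≔ b ]) a ≡ (h [ ℓ ≔ b ]) a′ → a ≡ a′
      inj′ {a} {a′} a∈ a′∈ eq with a ≟ᴬ ℓ | a′ ≟ᴬ ℓ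
      ... | yes refl | yes refl = refl
      ... | yes refl | no a′≢ℓ  = contradiction (subst (_∈ map f xs) (sym eq) (h-image a′∈ a′≢ℓ)) b∉
      ... | no a≢ℓ   | yes refl = contradiction (subst (_∈ map f xs) eq (h-image a∈ a≢ℓ)) b∉
      ... | no a≢ℓ   | no a′≢ℓ  = h-inj a∈ a′∈ a≢ℓ a′≢ℓ eq

    weaken : ∀ {L ℓ r} → Rerouted L ℓ → Rerouted (r ∷ L) ℓ
    weaken R = record
      { h = h ; h-pos = h-pos ; h-inj = h-inj ; h-image = h-image
      ; h-agree = λ { a∈ a∉ → h-agree a∈ λ { (here eq) → a∉ (here eq) ; (there a∈L) → a∉ (there (there a∈L)) } }
      }
      where open Rerouted R

    -- Here `ℓ` takes over `f r` and `r` becomes unmatched. Since `r` is outside `x ∷ L`, `h` still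
    -- sends it to `f r`, and injectivity of `h` shows that no other element holds this value.
    extend : ∀ {L ℓ r} → Rerouted L ℓ → ℓ ∈ x ∷ L → r ∈ xs → r ∉ x ∷ L → 0 < w ℓ (f r) →
             Rerouted (r ∷ L) r
    extend {L} {ℓ} {r} R ℓ∈ r∈ r∉ pos = record
      { h       = h [ ℓ ≔ f r ]
      ; h-pos   = pos′
      ; h-inj   = inj′
      ; h-image = image′
      ; h-agree = agree′
      }
      where
      open Rerouted R
      r≢ℓ : r ≢ ℓ
      r≢ℓ refl = r∉ ℓ∈
      avoids : ∀ {a} → a ∈ x ∷ xs → a ≢ ℓ → a ≢ r → h a ≢ f r
      avoids a∈ a≢ℓ a≢r eq = a≢r (h-inj a∈ (there r∈) a≢ℓ r≢ℓ (trans eq (sym (h-agree r∈ r∉))))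
      pos′ : ∀ {a} → a ∈ x ∷ xs → a ≢ r → 0 < w a ((h [ ℓ ≔ f r ]) a)
      pos′ {a} a∈ a≢r with a ≟ᴬ ℓ
      ... | yes refl = pos
      ... | no a≢ℓ   = h-pos a∈ a≢ℓ
      inj′ : ∀ {a a′} → a ∈ x ∷ xs → a′ ∈ x ∷ xs → a ≢ r → a′ ≢ r →
             (h [ ℓ ≔ f r ]) a ≡ (h [ ℓ ≔ f r ]) a′ → a ≡ a′
      inj′ {a} {a′} a∈ a′∈ a≢r a′≢r eq with a ≟ᴬ ℓ | a′ ≟ᴬ ℓ
      ... | yes refl | yes refl = refl
      ... | yes refl | no a′≢ℓ  = contradiction (sym eq) (avoids a′∈ a′≢ℓ a′≢r)
      ... | no a≢ℓ   | yes refl = contradiction eq (avoids a∈ a≢ℓ a≢r)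
      ... | no a≢ℓ   | no a′≢ℓ  = h-inj a∈ a′∈ a≢ℓ a′≢ℓ eq
      image′ : ∀ {a} → a ∈ x ∷ xs → a ≢ r → (h [ ℓ ≔ f r ]) a ∈ map f xs
      image′ {a} a∈ a≢r with a ≟ᴬ ℓ
      ... | yes refl = ∈-map⁺ f r∈
      ... | no a≢ℓ   = h-image a∈ a≢ℓ
      agree′ : ∀ {a} → a ∈ xs → a ∉ x ∷ r ∷ L → (h [ ℓ ≔ f r ]) a ≡ f a
      agree′ {a} a∈ a∉ = trans (≔-other h (f r) a≢ℓ) (h-agree a∈ a∉xL)
        where
        a∉xL : a ∉ x ∷ L
        a∉xL (here eq)  = a∉ (here eq)
        a∉xL (there a∈) = a∉ (there (there a∈))
        a≢ℓ : a ≢ ℓ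
        a≢ℓ refl = a∉xL ℓ∈

    -- Otherwise the rows of x ∷ L, of total weight at least (1 + |L|) W, would be supported
    -- on the |L| columns f(L), whose total weight is at most |L| W.
    escape : ∀ L rest → L ++ rest ↭ xs → ∃ λ ℓ → ∃ λ b → ℓ ∈ x ∷ L × 0 < w ℓ b × b ∉ map f L
    escape L rest perm
      with any? (λ ℓ → any? (λ b → (0 <? w ℓ b) ×-dec ¬? (b ∈? map f L)) ys) (x ∷ L)
    ... | yes found with ℓ , ℓ∈ , found′ ← find found
                    with b , _ , pos , b∉ ← find found′ = ℓ , b , ℓ∈ , pos , b∉
    ... | no none = contradiction (*-cancelʳ-≤ (suc (length L)) (length L) W {{>-nonZero W>0}} total) 1+n≰n
      where
      open ≤-Reasoning
      perm′ : (x ∷ L) ++ rest ↭ x ∷ xs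
      perm′ = Perm.prep x perm
      supp : ∀ {ℓ} → ℓ ∈ x ∷ L → ∀ {b} → b ∈ ys → 0 < w ℓ b → b ∈ map f L
      supp ℓ∈ {b} b∈ pos = decidable-stable (b ∈? map f L) λ b∉ → none (lose ℓ∈ (lose b∈ (pos , b∉)))
      total : suc (length L) * W ≤ length L * W
      total = begin
        suc (length L) * W
          ≡⟨ ∑-const (x ∷ L) W ⟨
        ∑ (x ∷ L) (λ _ → W)
          ≤⟨ ∑-mono (x ∷ L) (λ ℓ∈ → rows (∈-resp-↭ perm′ (∈-++⁺ˡ ℓ∈))) ⟩
        ∑ (x ∷ L) (λ ℓ → ∑ ys (w ℓ))
          ≤⟨ ∑-mono (x ∷ L) (λ {ℓ} ℓ∈ → ∑-support-≤ (map f L) (w ℓ) ys-unique (supp ℓ∈)) ⟩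
        ∑ (x ∷ L) (λ ℓ → ∑ (map f L) (w ℓ))
          ≡⟨ ∑-swap (x ∷ L) (map f L) w ⟩
        ∑ (map f L) (λ b → ∑ (x ∷ L) (λ ℓ → w ℓ b))
          ≤⟨ ∑-mono (map f L) (λ {b} _ → ≤-trans (m≤m+n _ (∑ rest (λ ℓ → w ℓ b)))
               (≤-trans (≤-reflexive (trans (sym (∑-++ (x ∷ L) rest _)) (∑-↭ _ perm′))) (cols b))) ⟩
        ∑ (map f L) (λ _ → W)
          ≡⟨ trans (∑-const (map f L) W) (cong (_* W) (length-map f L)) ⟩
        length L * W ∎

    explore : ∀ n L rest → length rest ≤ n → L ++ rest ↭ xs →
              (∀ {ℓ} → ℓ ∈ x ∷ L → Rerouted L ℓ) → ∃ (Matching (x ∷ xs))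
    explore n L rest len perm reach with ℓ , b , ℓ∈ , pos , b∉ ← escape L rest perm
      with b ∈? map f rest
    ... | no b∉rest = finish (reach ℓ∈) pos b∉xs
      where
      b∉xs : b ∉ map f xs
      b∉xs b∈ with a , a∈ , refl ← ∈-map⁻ f b∈ with ∈-++⁻ L (∈-resp-↭ (↭-sym perm) a∈)
      ... | inj₁ a∈L    = b∉ (∈-map⁺ f a∈L)
      ... | inj₂ a∈rest = b∉rest (∈-map⁺ f a∈rest)
    ... | yes b∈rest with r , r∈ , refl ← ∈-map⁻ f b∈rest
                     with us , vs , refl ← ∈-∃++ r∈ = next n len
      where
      r∈xs : r ∈ xs
      r∈xs = ∈-resp-↭ perm (∈-++⁺ʳ L r∈)
      r∉ : r ∉ x ∷ L
      r∉ (here refl) = x∉xs r∈xs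
      r∉ (there r∈L) = b∉ (∈-map⁺ f r∈L)
      reach′ : ∀ {k} → k ∈ x ∷ r ∷ L → Rerouted (r ∷ L) k
      reach′ (here refl)         = weaken (reach (here refl))
      reach′ (there (here refl)) = extend (reach ℓ∈) ℓ∈ r∈xs r∉ pos
      reach′ (there (there k∈))  = weaken (reach (there k∈))
      perm′ : r ∷ L ++ us ++ vs ↭ xs
      perm′ = ↭-trans (↭-sym (↭-trans (++⁺ˡ L (shift r us vs)) (shift r L (us ++ vs)))) perm
      len≡ : length (us ++ r ∷ vs) ≡ suc (length (us ++ vs))
      len≡ = ↭-length (shift r us vs)
      next : ∀ n → length (us ++ r ∷ vs) ≤ n → ∃ (Matching (x ∷ xs))
      next zero    le = contradiction (subst (_≤ 0) len≡ le) λ ()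
      next (suc n) le = explore n (r ∷ L) (us ++ vs) (s≤s⁻¹ (subst (_≤ suc n) len≡ le)) perm′ reach′

    augment : ∃ (Matching (x ∷ xs))
    augment = explore (length xs) [] xs ≤-refl ↭-refl λ { (here refl) → start }

  -- Elements are matched one at a time along augmenting paths. Rows of weight at least `W` against
  -- columns of weight at most `W` are a fractional form of Hall's condition, and the column bounds
  -- pass to the tail. `b₀` is a default value that provides some function when the list is empty.
  matching : B → ∀ {xs} → Unique xs → (∀ {a} → a ∈ xs → W ≤ ∑ ys (w a)) →
             (∀ b → ∑ xs (λ a → w a b) ≤ W) → ∃ (Matching xs)
  matching b₀ {[]}     _              _    _    = (λ _ → b₀) , (λ ()) , λ ()
  matching b₀ {x ∷ xs} u@(_ ∷ unique) rows cols
    with f , f-matching ← matching b₀ unique (rows ∘ there) (λ b → ≤-trans (m≤n+m _ (w x b)) (cols b))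
    = Augment.augment (Unique[x∷xs]⇒x∉xs u) f f-matching rows cols

-- Finite sets of vertices

_≟ˢ_ : ∀ {n} → DecidableEquality (Subset n)
_≟ˢ_ = Vec.≡-dec Bool._≟_

-- These index the columns of the weight matrices. All sizes are listed; `Edge` ensures that only
-- 4-sets get positive weight.
subsets : ∀ n → List (Subset n)
subsets zero    = [ [] ]
subsets (suc n) = map (true ∷_) (subsets n) ++ map (false ∷_) (subsets n)

∈-subsets : ∀ {n} (p : Subset n) → p ∈ subsets n
∈-subsets []          = here refl
∈-subsets (true  ∷ p) = ∈-++⁺ˡ (∈-map⁺ (true ∷_) (∈-subsets p))
∈-subsets (false ∷ p) = ∈-++⁺ʳ (map (true ∷_) (subsets _)) (∈-map⁺ (false ∷_) (∈-subsets p))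

subsets-unique : ∀ n → Unique (subsets n)
subsets-unique zero    = [] ∷ []
subsets-unique (suc n) = Unique-++⁺ (Unique-map⁺ Vec.∷-injectiveʳ (subsets-unique n))
                                    (Unique-map⁺ Vec.∷-injectiveʳ (subsets-unique n)) disjoint
  where
  disjoint : ∀ {p} → p ∈ map (true ∷_) (subsets n) × p ∈ map (false ∷_) (subsets n) → Empty
  disjoint (p∈₁ , p∈₂) with _ , _ , refl ← ∈-map⁻ (true ∷_) p∈₁ with _ , _ , () ← ∈-map⁻ (false ∷_) p∈₂

elements : ∀ {n} → Subset n → List (Fin n)
elements []          = []
elements (true  ∷ p) = zero ∷ map suc (elements p)
elements (false ∷ p) = map suc (elements p)

length-elements : ∀ {n} (p : Subset n) → length (elements p) ≡ ∣ p ∣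
length-elements []          = refl
length-elements (true  ∷ p) = cong suc (trans (length-map suc (elements p)) (length-elements p))
length-elements (false ∷ p) = trans (length-map suc (elements p)) (length-elements p)

∈-elements : ∀ {n} {p : Subset n} {x} → x ∈ˢ p → x ∈ elements p
∈-elements {p = true  ∷ p} here       = here refl
∈-elements {p = true  ∷ p} (there x∈) = there (∈-map⁺ suc (∈-elements x∈))
∈-elements {p = false ∷ p} (there x∈) = ∈-map⁺ suc (∈-elements x∈)

∣⁅x⁆∪p∣ : ∀ {n} (x : Fin n) p → x ∉ˢ p → ∣ ⁅ x ⁆ ∪ p ∣ ≡ suc ∣ p ∣
∣⁅x⁆∪p∣ zero    (true  ∷ p) x∉ = contradiction here x∉
∣⁅x⁆∪p∣ zero    (false ∷ p) x∉ = cong (suc ∘ ∣_∣) (Sub.∪-identityˡ p)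
∣⁅x⁆∪p∣ (suc x) (true  ∷ p) x∉ = cong suc (∣⁅x⁆∪p∣ x p (x∉ ∘ there))
∣⁅x⁆∪p∣ (suc x) (false ∷ p) x∉ = ∣⁅x⁆∪p∣ x p (x∉ ∘ there)

fromList : ∀ {n} → List (Fin n) → Subset n
fromList []       = ⊥
fromList (x ∷ xs) = ⁅ x ⁆ ∪ fromList xs

module _ {n : ℕ} where

  ∈-fromList⁺ : ∀ {x : Fin n} {xs} → x ∈ xs → x ∈ˢ fromList xs
  ∈-fromList⁺ {x} (here refl) = Sub.x∈p∪q⁺ (inj₁ (Sub.x∈⁅x⁆ x))
  ∈-fromList⁺     (there x∈)  = Sub.x∈p∪q⁺ (inj₂ (∈-fromList⁺ x∈))

  ∈-fromList⁻ : ∀ {x : Fin n} xs → x ∈ˢ fromList xs → x ∈ xs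
  ∈-fromList⁻ []       x∈ = contradiction x∈ Sub.∉⊥
  ∈-fromList⁻ (y ∷ xs) x∈ with Sub.x∈p∪q⁻ ⁅ y ⁆ (fromList xs) x∈
  ... | inj₁ x∈y  = here (Sub.x∈⁅y⁆⇒x≡y y x∈y)
  ... | inj₂ x∈xs = there (∈-fromList⁻ xs x∈xs)

  ∣fromList∣ : ∀ {xs : List (Fin n)} → Unique xs → ∣ fromList xs ∣ ≡ length xs
  ∣fromList∣ {[]}     _           = Sub.∣⊥∣≡0 n
  ∣fromList∣ {x ∷ xs} u@(_ ∷ u′) =
    trans (∣⁅x⁆∪p∣ x (fromList xs) (Unique[x∷xs]⇒x∉xs u ∘ ∈-fromList⁻ xs)) (cong suc (∣fromList∣ u′))

  fromList-⊆ : ∀ {xs : List (Fin n)} {p} → (∀ {x} → x ∈ xs → x ∈ˢ p) → fromList xs ⊆ p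
  fromList-⊆ {xs} xs⊆p = xs⊆p ∘ ∈-fromList⁻ xs

  fromList-cong : ∀ {xs ys : List (Fin n)} → (∀ {x} → x ∈ xs → x ∈ ys) → (∀ {x} → x ∈ ys → x ∈ xs) →
                  fromList xs ≡ fromList ys
  fromList-cong xs⊆ys ys⊆xs = Sub.⊆-antisym (fromList-⊆ (∈-fromList⁺ ∘ xs⊆ys)) (fromList-⊆ (∈-fromList⁺ ∘ ys⊆xs))

  open import Data.List.Membership.DecPropositional (Fin._≟_ {n}) using (_∈?_)

  ∑-∈-≤ : ∀ (xs : List (Fin n)) → ∑ (allFin n) (λ y → 𝟙 (y ∈? xs)) ≤ length xs
  ∑-∈-≤ xs = ≤-trans (∑𝟙-image-≤ (_∈? xs) id xs (λ _ → 1) (allFin⁺ n) (λ _ _ → id) (λ x∈ → x∈ , ≤-refl))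
                     (≤-reflexive (trans (∑-const xs 1) (*-identityʳ _)))

  length-allFin : length (allFin n) ≡ n
  length-allFin = length-tabulate id

  fresh : ∀ (xs : List (Fin n)) → length xs < n → ∃ λ x → x ∉ xs
  fresh xs len with Fin.any? (λ x → ¬? (x ∈? xs))
  ... | yes found = found
  ... | no none = contradiction n≤len (<⇒≱ len)
    where
    n≤len : n ≤ length xs
    n≤len = subst₂ _≤_ length-allFin (+-identityʳ _)
      (union-bound (allFin n) (((λ y → 𝟙 (y ∈? xs)) , length xs) ∷ []) (∑-∈-≤ xs ∷ [])
        λ y → here (𝟙-yes (y ∈? xs) (decidable-stable (y ∈? xs) λ y∉ → none (y , y∉))))

  -- Otherwise `x ∷ xs` would list more distinct elements of `e` than there are.
  exhausts : ∀ {xs : List (Fin n)} {e x} → Unique xs → (∀ {x} → x ∈ xs → x ∈ˢ e) →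
             length xs ≡ ∣ e ∣ → x ∈ˢ e → x ∈ xs
  exhausts {xs} {e} {x} uniq xs⊆e card x∈e = decidable-stable (x ∈? xs) λ x∉ →
    1+n≰n (≤-trans (≤-reflexive (sym (∣fromList∣ (All.tabulate (λ y∈ x≡y → x∉ (subst (_∈ xs) (sym x≡y) y∈)) ∷ uniq))))
      (≤-trans (Sub.p⊆q⇒∣p∣≤∣q∣ (fromList-⊆ {xs = x ∷ xs} λ { (here refl) → x∈e ; (there y∈) → xs⊆e y∈ }))
        (≤-reflexive (sym card))))

-- Sorted pairs of vertices

Pair : ℕ → Set
Pair n = Fin n × Fin n

_≟ᴾ_ : ∀ {n} → DecidableEquality (Pair n)
_≟ᴾ_ = ≡-dec Fin._≟_ Fin._≟_

Within : ∀ {n} → Subset n → Pair n → Set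
Within e (u , v) = u Fin.< v × u ∈ˢ e × v ∈ˢ e

within? : ∀ {n} (e : Subset n) → Decidable (Within e)
within? e (u , v) = (u Fin.<? v) ×-dec ((u Sub.∈? e) ×-dec (v Sub.∈? e))

module _ {n : ℕ} where

  bothOrders : Fin n → List (Fin n) → List (Pair n)
  bothOrders x []       = []
  bothOrders x (y ∷ ys) = (x , y) ∷ (y , x) ∷ bothOrders x ys

  ∈-bothOrders : ∀ {x y : Fin n} {ys} → y ∈ ys →
                 (x , y) ∈ bothOrders x ys × (y , x) ∈ bothOrders x ys
  ∈-bothOrders (here refl) = here refl , there (here refl)
  ∈-bothOrders (there y∈) with xy∈ , yx∈ ← ∈-bothOrders y∈ = there (there xy∈) , there (there yx∈)

  distinctPairs : List (Fin n) → List (Pair n)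
  distinctPairs []       = []
  distinctPairs (x ∷ xs) = bothOrders x xs ++ distinctPairs xs

  ∈-distinctPairs : ∀ {u v : Fin n} {xs} → u ≢ v → u ∈ xs → v ∈ xs → (u , v) ∈ distinctPairs xs
  ∈-distinctPairs u≢v (here refl) (here refl) = contradiction refl u≢v
  ∈-distinctPairs u≢v (here refl) (there v∈)  = ∈-++⁺ˡ (proj₁ (∈-bothOrders v∈))
  ∈-distinctPairs u≢v (there u∈)  (here refl) = ∈-++⁺ˡ (proj₂ (∈-bothOrders u∈))
  ∈-distinctPairs u≢v (there u∈)  (there v∈)  = ∈-++⁺ʳ (bothOrders _ _) (∈-distinctPairs u≢v u∈ v∈)

  -- At most one order of two given vertices is increasing, so the list containing both orders of
  -- each pair contributes at most 3 + 2 + 1 + 0.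
  pairs-within-4-set : ∀ {xs : List (Pair n)} {e} → Unique xs → ∣ e ∣ ≡ 4 →
                       ∑ xs (λ q → 𝟙 (within? e q)) ≤ 6
  pairs-within-4-set {xs} {e} uniq card =
    ≤-trans (∑-support-≤ (distinctPairs (elements e)) F uniq supp)
            (bound (elements e) (trans (length-elements e) card))
    where
    F : Pair n → ℕ
    F q = 𝟙 (within? e q)
    supp : ∀ {q} → q ∈ xs → 0 < F q → q ∈ distinctPairs (elements e)
    supp {q} _ pos with u<v , u∈ , v∈ ← 𝟙-pos (within? e q) pos =
      ∈-distinctPairs (Fin.<⇒≢ u<v) (∈-elements u∈) (∈-elements v∈)
    one-order : ∀ x y → F (x , y) + F (y , x) ≤ 1
    one-order x y with within? e (x , y) | within? e (y , x)
    ... | yes (x<y , _) | yes (y<x , _) = contradiction y<x (Fin.<-asym x<y)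
    ... | yes _ | no _  = ≤-refl
    ... | no _  | yes _ = ≤-refl
    ... | no _  | no _  = z≤n
    row : ∀ x ys → ∑ (bothOrders x ys) F ≤ length ys
    row x []       = z≤n
    row x (y ∷ ys) = subst (_≤ suc (length ys)) (+-assoc (F (x , y)) (F (y , x)) _)
                       (+-mono-≤ (one-order x y) (row x ys))
    rows : ∀ x ys {k} → ∑ (distinctPairs ys) F ≤ k → ∑ (distinctPairs (x ∷ ys)) F ≤ length ys + k
    rows x ys le = subst (_≤ _) (sym (∑-++ (bothOrders x ys) (distinctPairs ys) F)) (+-mono-≤ (row x ys) le)
    bound : ∀ E → length E ≡ 4 → ∑ (distinctPairs E) F ≤ 6
    bound (a ∷ b ∷ c ∷ d ∷ []) refl =
      rows a (b ∷ c ∷ d ∷ []) (rows b (c ∷ d ∷ []) (rows c (d ∷ []) (rows d [] z≤n)))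

sortedPairs : ∀ n → List (Pair n)
sortedPairs n = filter (λ { (u , v) → u Fin.<? v }) (cartesianProduct (allFin n) (allFin n))

sortedPairs-unique : ∀ n → Unique (sortedPairs n)
sortedPairs-unique n = filter⁺ _ (cartesianProduct⁺ (allFin⁺ n) (allFin⁺ n))

∈-sortedPairs⁺ : ∀ {n} {u v : Fin n} → u Fin.< v → (u , v) ∈ sortedPairs n
∈-sortedPairs⁺ {u = u} {v} u<v = ∈-filter⁺ _ (∈-cartesianProduct⁺ (∈-allFin u) (∈-allFin v)) u<v

∈-sortedPairs⁻ : ∀ {n} {u v : Fin n} → (u , v) ∈ sortedPairs n → u Fin.< v
∈-sortedPairs⁻ {n} q∈ = proj₂ (∈-filter⁻ (λ { (u , v) → u Fin.<? v }) {xs = cartesianProduct (allFin n) (allFin n)} q∈)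

-- A set of two vertices has only one increasing enumeration.
sorted-unique : ∀ {n} {u v u′ v′ : Fin n} → u Fin.< v → u′ Fin.< v′ →
                u ∈ u′ ∷ v′ ∷ [] → v ∈ u′ ∷ v′ ∷ [] → (u , v) ≡ (u′ , v′)
sorted-unique u<v u′<v′ (here refl)         (here refl)         = contradiction u<v (Fin.<-irrefl refl)
sorted-unique u<v u′<v′ (here refl)         (there (here refl)) = refl
sorted-unique u<v u′<v′ (there (here refl)) (here refl)         = contradiction u<v (Fin.<-asym u′<v′)
sorted-unique u<v u′<v′ (there (here refl)) (there (here refl)) = contradiction u<v (Fin.<-irrefl refl)

snoc-unique : {A : Set} {xs : List A} {y : A} → Unique xs → y ∉ xs → Unique (xs ++ [ y ])
snoc-unique uniq y∉ = Unique-++⁺ uniq ([] ∷ []) λ { (y∈ , here refl) → y∉ y∈ }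

-- Order-preserving embeddings

StrictlyMonotone : ∀ {m n} → (Fin m → Fin n) → Set
StrictlyMonotone φ = ∀ {u v} → u Fin.< v → φ u Fin.< φ v

mono⇒injective : ∀ {m n} {φ : Fin m → Fin n} → StrictlyMonotone φ → ∀ {u v} → φ u ≡ φ v → u ≡ v
mono⇒injective mono {u} {v} eq with Fin.<-cmp u v
... | tri< u<v _ _ = contradiction eq (Fin.<⇒≢ (mono u<v))
... | tri≈ _ u≡v _ = u≡v
... | tri> _ _ v<u = contradiction (sym eq) (Fin.<⇒≢ (mono v<u))

punchIn-mono : ∀ {n} (i : Fin (suc n)) → StrictlyMonotone (Fin.punchIn i)
punchIn-mono i {u} {v} u<v =
  Fin.≤∧≢⇒< (Fin.punchIn-mono-≤ i u v (<⇒≤ u<v)) (Fin.<⇒≢ u<v ∘ Fin.punchIn-injective i u v)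

inject≤-mono : ∀ {m n} .(m≤n : m ≤ n) → StrictlyMonotone (λ (i : Fin m) → Fin.inject≤ i m≤n)
inject≤-mono m≤n {u} {v} u<v
  rewrite Fin.toℕ-inject≤ u m≤n | Fin.toℕ-inject≤ v m≤n = u<v

avoiding-two : ∀ {s t} → s + 2 ≤ t → (z z′ : Fin t) → z ≢ z′ →
               Σ (Fin s → Fin t) λ φ → StrictlyMonotone φ × (∀ u → φ u ∉ z ∷ z′ ∷ [])
avoiding-two {s} {t} s+2≤t z z′ z≢z′ with subst (_≤ t) (+-comm s 2) s+2≤t
... | s≤s (s≤s {n = n} s≤n) = φ , φ-mono , φ-avoids
  where
  -- After the removal of `z`, the vertex `z′` is named `y`; the embedding skips first `y` and then
  -- `z`.
  y : Fin (suc n)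
  y = Fin.punchOut z≢z′
  φ : Fin s → Fin (suc (suc n))
  φ u = Fin.punchIn z (Fin.punchIn y (Fin.inject≤ u s≤n))
  φ-mono : StrictlyMonotone φ
  φ-mono u<v = punchIn-mono z (punchIn-mono y (inject≤-mono s≤n u<v))
  φ-avoids : ∀ u → φ u ∉ z ∷ z′ ∷ []
  φ-avoids u (here eq)         = Fin.punchInᵢ≢i z _ eq
  φ-avoids u (there (here eq)) = Fin.punchInᵢ≢i y _
    (Fin.punchIn-injective z _ _ (trans eq (sym (Fin.punchIn-punchOut z≢z′))))

-- Quadruples of vertices and low pairs

module _ {t : ℕ} where

  init-∈ : ∀ {a b x y u : Fin t} → u ∈ a ∷ b ∷ x ∷ [] → u ∈ a ∷ b ∷ x ∷ y ∷ []
  init-∈ = ∈-++⁺ˡ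

  last-∈ : ∀ {a b x y : Fin t} → y ∈ a ∷ b ∷ x ∷ y ∷ []
  last-∈ = there (there (there (here refl)))

  last∉init : ∀ {a b x y : Fin t} → Unique (a ∷ b ∷ x ∷ y ∷ []) → y ∉ a ∷ b ∷ x ∷ []
  last∉init ((_ ∷ _ ∷ a≢y ∷ []) ∷ _)               (here eq)                 = a≢y (sym eq)
  last∉init (_ ∷ (_ ∷ b≢y ∷ []) ∷ _)               (there (here eq))         = b≢y (sym eq)
  last∉init (_ ∷ _ ∷ (x≢y ∷ []) ∷ _)               (there (there (here eq))) = x≢y (sym eq)

  quad-last-injective : ∀ {a b x y y′ : Fin t} → Unique (a ∷ b ∷ x ∷ y ∷ []) →
    fromList (a ∷ b ∷ x ∷ y ∷ []) ≡ fromList (a ∷ b ∷ x ∷ y′ ∷ []) → y ≡ y′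
  quad-last-injective {a} {b} {x} {y} {y′} uniq eq
    with ∈-++⁻ (a ∷ b ∷ x ∷ []) (∈-fromList⁻ (a ∷ b ∷ x ∷ y′ ∷ [])
           (subst (y ∈ˢ_) eq (∈-fromList⁺ (last-∈ {a} {b} {x}))))
  ... | inj₁ y∈          = contradiction y∈ (last∉init uniq)
  ... | inj₂ (here y≡y′) = y≡y′

  in-last-two : ∀ {a b x y u : Fin t} → u ∈ˢ fromList (a ∷ b ∷ x ∷ y ∷ []) → u ∉ a ∷ b ∷ [] → u ∈ x ∷ y ∷ []
  in-last-two {a} {b} {x} {y} u∈ u∉ with ∈-++⁻ (a ∷ b ∷ []) (∈-fromList⁻ (a ∷ b ∷ x ∷ y ∷ []) u∈)
  ... | inj₁ u∈ab = contradiction u∈ab u∉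
  ... | inj₂ u∈xy = u∈xy

module _ {t : ℕ} (c : Colouring t) where

  open import Data.List.Membership.DecPropositional (Fin._≟_ {t}) using (_∈?_)
  open import Data.List.Relation.Unary.Unique.DecPropositional (Fin._≟_ {t}) using (unique?)

  record Edge (col : Bool) (q : Pair t) (e : Subset t) : Set where
    constructor edge
    field
      card   : ∣ e ∣ ≡ 4
      colour : c e ≡ col
      left   : proj₁ q ∈ˢ e
      right  : proj₂ q ∈ˢ e

  edge? : ∀ col q e → Dec (Edge col q e)
  edge? col (u , v) e = map′ (λ { (a , b , c , d) → edge a b c d }) (λ { (edge a b c d) → a , b , c , d })
    ((∣ e ∣ ≟ 4) ×-dec (c e Bool.≟ col) ×-dec (u Sub.∈? e) ×-dec (v Sub.∈? e))

  deg : Bool → Pair t → ℕ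
  deg col q = ∑ (subsets t) (λ e → 𝟙 (edge? col q e))

  Low : Bool → Pair t → Set
  Low col q = deg col q ≤ 5

  low? : ∀ col q → Dec (Low col q)
  low? col q = deg col q ≤? 5

  -- Distinct representatives for the pairs in the image of `φ` form a Berge clique, with `ψ` the
  -- composite of `f` with `φ`. A monotone `φ` is injective and keeps sorted pairs sorted, so
  -- representatives of sorted pairs suffice.
  berge : ∀ {k col} {φ : Fin k → Fin t} → StrictlyMonotone φ → (f : Pair t → Subset t) →
          (∀ {u v} → u Fin.< v → Edge col (φ u , φ v) (f (φ u , φ v))) →
          (∀ {u v u′ v′} → u Fin.< v → u′ Fin.< v′ → f (φ u , φ v) ≡ f (φ u′ , φ v′) →
             (φ u , φ v) ≡ (φ u′ , φ v′)) →
          HasBergeK 4 t c col k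
  berge {φ = φ} mono f edges inj =
    φ , mono⇒injective mono , (λ u v → f (φ u , φ v)) ,
    (λ u v u<v → let open Edge (edges u<v) in card , colour , left , right) ,
    λ u v u′ v′ u<v u′<v′ eq → let eqs = inj u<v u′<v′ eq in
      mono⇒injective mono (cong proj₁ eqs) , mono⇒injective mono (cong proj₂ eqs)

  -- The order of the vertices records their roles: `a`, `b` is the candidate for a blue-low pair,
  -- and `x`, `y` is the pair it is joined to.
  Quad : Bool → (a b x y : Fin t) → Set
  Quad col a b x y = Unique (a ∷ b ∷ x ∷ y ∷ []) × c (fromList (a ∷ b ∷ x ∷ y ∷ [])) ≡ col

  quad? : ∀ col a b x y → Dec (Quad col a b x y)
  quad? col a b x y = unique? (a ∷ b ∷ x ∷ y ∷ []) ×-dec (c (fromList (a ∷ b ∷ x ∷ y ∷ [])) Bool.≟ col)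

  quad-edge : ∀ {col a b x y u v} → Quad col a b x y → u ∈ a ∷ b ∷ x ∷ y ∷ [] → v ∈ a ∷ b ∷ x ∷ y ∷ [] →
              Edge col (u , v) (fromList (a ∷ b ∷ x ∷ y ∷ []))
  quad-edge (uniq , col) u∈ v∈ = edge (∣fromList∣ uniq) col (∈-fromList⁺ u∈) (∈-fromList⁺ v∈)

  quad-swap : ∀ {col a b x y} → Quad col a b x y → Quad col a b y x
  quad-swap {col} {a} {b} {x} {y} (((a≢b ∷ a≢x ∷ a≢y ∷ []) ∷ (b≢x ∷ b≢y ∷ []) ∷ (x≢y ∷ []) ∷ [] ∷ []) , colour) =
    ((a≢b ∷ a≢y ∷ a≢x ∷ []) ∷ (b≢y ∷ b≢x ∷ []) ∷ ((x≢y ∘ sym) ∷ []) ∷ [] ∷ []) ,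
    trans (cong c (fromList-cong (∈-resp-↭ (swap-last y x)) (∈-resp-↭ (swap-last x y)))) colour
    where
    swap-last : ∀ u v → a ∷ b ∷ u ∷ v ∷ [] ↭ a ∷ b ∷ v ∷ u ∷ []
    swap-last u v = prep a (prep b (swap u v ↭-refl))

  -- Different `y` give different hyperedges, all containing `u` and `v`. Hence a low pair inside a
  -- triple limits the quadruples of its colour through that triple.
  quads≤deg : ∀ {col a b x u v} → u ∈ a ∷ b ∷ x ∷ [] → v ∈ a ∷ b ∷ x ∷ [] →
              ∑ (allFin t) (λ y → 𝟙 (quad? col a b x y)) ≤ deg col (u , v)
  quads≤deg {col} {a} {b} {x} {u} {v} u∈ v∈ =
    ∑𝟙-image-≤ (quad? col a b x) (λ y → fromList (a ∷ b ∷ x ∷ y ∷ [])) (subsets t) _ (allFin⁺ t)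
      (λ (uniq , _) _ → quad-last-injective uniq)
      λ q → ∈-subsets _ , 𝟙-yes (edge? col (u , v) _) (quad-edge q (init-∈ u∈) (init-∈ v∈))

  red-or-blue : ∀ {a b x} → Unique (a ∷ b ∷ x ∷ []) → ∀ y →
                y ∈ a ∷ b ∷ x ∷ [] ⊎ Quad false a b x y ⊎ Quad true a b x y
  red-or-blue {a} {b} {x} uniq y with y ∈? a ∷ b ∷ x ∷ [] | c (fromList (a ∷ b ∷ x ∷ y ∷ []))
  ... | yes y∈ | _     = inj₁ y∈
  ... | no  y∉ | false = inj₂ (inj₁ (snoc-unique uniq y∉ , refl))
  ... | no  y∉ | true  = inj₂ (inj₂ (snoc-unique uniq y∉ , refl))

  -- Every vertex `y` is one of the 3 in the triple, one of at most 5 for which `abxy` is blue, or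
  -- one of at most 5 for which it is red, so `t` would be at most 13.
  low-clash : 14 ≤ t → ∀ {a b x u v} → Unique (a ∷ b ∷ x ∷ []) → u ∈ a ∷ b ∷ x ∷ [] → v ∈ a ∷ b ∷ x ∷ [] →
              Low false (a , b) → Low true (u , v) → Empty
  low-clash 14≤t {a} {b} {x} {u} {v} uniq u∈ v∈ blue red = contradiction (≤-trans 14≤t t≤13) (<⇒≱ ≤-refl)
    where
    cover : ∀ y → Any (λ (f , _) → 0 < f y) _
    cover y with red-or-blue uniq y
    ... | inj₁ y∈       = here (𝟙-yes (y ∈? a ∷ b ∷ x ∷ []) y∈)
    ... | inj₂ (inj₁ q) = there (here (𝟙-yes (quad? false a b x y) q))
    ... | inj₂ (inj₂ q) = there (there (here (𝟙-yes (quad? true a b x y) q)))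
    t≤13 : t ≤ 13
    t≤13 = subst (_≤ 13) length-allFin (union-bound (allFin t)
      (((λ y → 𝟙 (y ∈? a ∷ b ∷ x ∷ [])) , 3) ∷ ((λ y → 𝟙 (quad? false a b x y)) , 5) ∷
       ((λ y → 𝟙 (quad? true a b x y)) , 5) ∷ [])
      (∑-∈-≤ (a ∷ b ∷ x ∷ []) ∷
       ≤-trans (quads≤deg {false} {a} {b} {x} (here refl) (there (here refl))) blue ∷
       ≤-trans (quads≤deg {true} {a} {b} {x} u∈ v∈) red ∷ [])
      cover)

  -- If the two pairs met, some triple would contain both, against `low-clash`.
  low-disjoint : 14 ≤ t → ∀ {a b u v} → a ≢ b → Low false (a , b) → Low true (u , v) →
                 (u ∉ a ∷ b ∷ []) × (v ∉ a ∷ b ∷ [])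
  low-disjoint 14≤t {a} {b} {u} {v} a≢b blue red = go (u ∈? a ∷ b ∷ []) (v ∈? a ∷ b ∷ [])
    where
    ab : Unique (a ∷ b ∷ [])
    ab = (a≢b ∷ []) ∷ [] ∷ []
    go : Dec (u ∈ a ∷ b ∷ []) → Dec (v ∈ a ∷ b ∷ []) → (u ∉ a ∷ b ∷ []) × (v ∉ a ∷ b ∷ [])
    go (no u∉)  (no v∉)  = u∉ , v∉
    go (yes u∈) (no v∉)  =
      ⊥-elim (low-clash 14≤t (snoc-unique ab v∉) (∈-++⁺ˡ u∈) (there (there (here refl))) blue red)
    go (no u∉)  (yes v∈) =
      ⊥-elim (low-clash 14≤t (snoc-unique ab u∉) (there (there (here refl))) (∈-++⁺ˡ v∈) blue red)
    -- Both ends lie in the blue-low pair, so any further vertex completes the triple.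
    go (yes u∈) (yes v∈) with x , x∉ ← fresh (a ∷ b ∷ []) (≤-trans (s≤s (s≤s (s≤s z≤n))) 14≤t) =
      ⊥-elim (low-clash 14≤t (snoc-unique ab x∉) (∈-++⁺ˡ u∈) (∈-++⁺ˡ v∈) blue red)

-- The blue clique

module Blue {s t : ℕ} (c : Colouring t) (s+2≤t : s + 2 ≤ t) {z z′ : Fin t} (z≢z′ : z ≢ z′)
  (unblocked : ¬ ∃ λ a → ∃ λ b → Low c false (a , b) × Quad c true a b z z′) where

  open import Data.List.Membership.DecPropositional (Fin._≟_ {t}) using (_∈?_)

  Core : Pair t → Set
  Core (u , v) = (u ∉ z ∷ z′ ∷ []) × (v ∉ z ∷ z′ ∷ [])

  core? : Decidable Core
  core? (u , v) = ¬? (u ∈? z ∷ z′ ∷ []) ×-dec ¬? (v ∈? z ∷ z′ ∷ [])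

  corePairs : List (Pair t)
  corePairs = filter core? (sortedPairs t)

  corePairs-unique : Unique corePairs
  corePairs-unique = filter⁺ core? (sortedPairs-unique t)

  ∈-corePairs⁻ : ∀ {u v} → (u , v) ∈ corePairs → u Fin.< v × Core (u , v)
  ∈-corePairs⁻ q∈ with q∈′ , core ← ∈-filter⁻ core? {xs = sortedPairs t} q∈ = ∈-sortedPairs⁻ q∈′ , core

  core-unique : ∀ {u v} → u Fin.< v → Core (u , v) → Unique (u ∷ v ∷ z ∷ z′ ∷ [])
  core-unique u<v (u∉ , v∉) =
    (Fin.<⇒≢ u<v ∷ (λ eq → u∉ (here eq)) ∷ (λ eq → u∉ (there (here eq))) ∷ []) ∷
    ((λ eq → v∉ (here eq)) ∷ (λ eq → v∉ (there (here eq))) ∷ []) ∷ (z≢z′ ∷ []) ∷ [] ∷ []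

  Full : Subset t → Set
  Full e = z ∈ˢ e × z′ ∈ˢ e

  full? : Decidable Full
  full? e = (z Sub.∈? e) ×-dec (z′ Sub.∈? e)

  -- `E` stands for being a blue hyperedge on the pair, `F` for containing `z` and `z′`. A 4-set has
  -- six pairs, but if it contains `z` and `z′` only one of them avoids both; hence 1 against 6.
  wt : {E F : Set} → Dec E → Dec F → ℕ
  wt (no  _) _       = 0
  wt (yes _) (yes _) = 6
  wt (yes _) (no  _) = 1

  w : Pair t → Subset t → ℕ
  w q e = wt (edge? c false q e) (full? e)

  wt≤6 : {E F : Set} (E? : Dec E) (F? : Dec F) → wt E? F? ≤ 6
  wt≤6 (no  _) _       = z≤n
  wt≤6 (yes _) (yes _) = ≤-refl
  wt≤6 (yes _) (no  _) = s≤s z≤n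

  wt-pos : {E F : Set} (E? : Dec E) (F? : Dec F) → 0 < wt E? F? → E
  wt-pos (yes e) _ _ = e

  wt-full : {E F : Set} (E? : Dec E) (F? : Dec F) → E → F → 6 ≤ wt E? F?
  wt-full (yes _) (yes _) _ _ = ≤-refl
  wt-full (yes _) (no ¬f) _ f = contradiction f ¬f
  wt-full (no ¬e) _       e _ = contradiction e ¬e

  𝟙≤wt : {E F : Set} (E? : Dec E) (F? : Dec F) → 𝟙 E? ≤ wt E? F?
  𝟙≤wt (no  _) _       = z≤n
  𝟙≤wt (yes _) (yes _) = s≤s z≤n
  𝟙≤wt (yes _) (no  _) = ≤-refl

  wt-not-full : {E F P : Set} (E? : Dec E) (F? : Dec F) (P? : Dec P) → ¬ F → (E → P) → wt E? F? ≤ 𝟙 P?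
  wt-not-full (no  _) _       _  _  _ = z≤n
  wt-not-full (yes _) (yes f) _  ¬f _ = contradiction f ¬f
  wt-not-full (yes e) (no  _) P? _  i = 𝟙-yes P? (i e)

  -- If `uvzz′` is blue, it alone has weight 6. If it is red, then by `unblocked` the pair is not
  -- blue-low, and at least six blue hyperedges contribute 1 or more each.
  rows : ∀ {q} → q ∈ corePairs → 6 ≤ ∑ (subsets t) (w q)
  rows {u , v} q∈ = go (quad? c true u v z z′)
    where
    zw-edge : Subset t
    zw-edge = fromList (u ∷ v ∷ z ∷ z′ ∷ [])
    uniq : Unique (u ∷ v ∷ z ∷ z′ ∷ [])
    uniq = core-unique (proj₁ (∈-corePairs⁻ q∈)) (proj₂ (∈-corePairs⁻ q∈))
    go : Dec (Quad c true u v z z′) → 6 ≤ ∑ (subsets t) (w (u , v))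
    go (yes red) = ≤-trans (≰⇒> (λ low → unblocked (u , v , low , red)))
      (∑-mono (subsets t) λ {e} _ → 𝟙≤wt (edge? c false (u , v) e) (full? e))
    go (no ¬red) = ≤-trans
      (wt-full (edge? c false (u , v) zw-edge) (full? zw-edge)
        (quad-edge c (uniq , Bool.¬-not (λ eq → ¬red (uniq , eq))) (here refl) (there (here refl)))
        (∈-fromList⁺ {xs = u ∷ v ∷ z ∷ z′ ∷ []} (there (there (here refl))) ,
         ∈-fromList⁺ {xs = u ∷ v ∷ z ∷ z′ ∷ []} (there (there (there (here refl))))))
      (∈⇒≤∑ (w (u , v)) (∈-subsets zw-edge))

  -- Apart from `z` and `z′` a full hyperedge has two vertices, which leaves room for one core pair.
  full-same : ∀ {e q q′} → Full e → q ∈ corePairs → q′ ∈ corePairs →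
              Edge c false q e → Edge c false q′ e → q ≡ q′
  full-same {e} {u , v} {u′ , v′} (z∈ , z′∈) q∈ q′∈ E E′ =
    sorted-unique u<v (proj₁ (∈-corePairs⁻ q′∈)) (in-pair (Edge.left E) (proj₁ core)) (in-pair (Edge.right E) (proj₂ core))
    where
    u<v : u Fin.< v
    u<v = proj₁ (∈-corePairs⁻ q∈)
    core : Core (u , v)
    core = proj₂ (∈-corePairs⁻ q∈)
    all∈e : ∀ {x} → x ∈ u′ ∷ v′ ∷ z ∷ z′ ∷ [] → x ∈ˢ e
    all∈e (here refl)                         = Edge.left E′
    all∈e (there (here refl))                 = Edge.right E′
    all∈e (there (there (here refl)))         = z∈
    all∈e (there (there (there (here refl)))) = z′∈
    in-pair : ∀ {x} → x ∈ˢ e → x ∉ z ∷ z′ ∷ [] → x ∈ u′ ∷ v′ ∷ []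
    in-pair x∈ x∉ with ∈-++⁻ (u′ ∷ v′ ∷ []) (exhausts (core-unique (proj₁ (∈-corePairs⁻ q′∈)) (proj₂ (∈-corePairs⁻ q′∈)))
                                              all∈e (sym (Edge.card E)) x∈)
    ... | inj₁ x∈′ = x∈′
    ... | inj₂ x∈′ = contradiction x∈′ x∉

  cols : ∀ e → ∑ corePairs (λ q → w q e) ≤ 6
  cols e = go (∣ e ∣ ≟ 4) (full? e)
    where
    pos : ∀ {q} F? → 0 < wt (edge? c false q e) F? → Edge c false q e
    pos {q} F? = wt-pos {F = Full e} (edge? c false q e) F?
    go : Dec (∣ e ∣ ≡ 4) → (F? : Dec (Full e)) → ∑ corePairs (λ q → wt (edge? c false q e) F?) ≤ 6
    -- Only 4-sets have positive weight, so the condition on two positive terms is vacuous.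
    go (no ≢4) F? = ∑-at-most-one corePairs-unique (λ q → wt≤6 (edge? c false q e) F?)
      λ _ _ p → contradiction (Edge.card (pos F? p)) ≢4
    go (yes ≡4) (yes full) = ∑-at-most-one corePairs-unique (λ q → wt≤6 (edge? c false q e) (yes full))
      λ q∈ q′∈ p p′ → full-same full q∈ q′∈ (pos (yes full) p) (pos (yes full) p′)
    go (yes ≡4) (no ¬full) = ≤-trans
      (∑-mono corePairs λ {q} q∈ → wt-not-full (edge? c false q e) (no ¬full) (within? e q) ¬full
        λ E → proj₁ (∈-corePairs⁻ q∈) , Edge.left E , Edge.right E)
      (pairs-within-4-set corePairs-unique ≡4)

  -- All pairs avoiding `z` and `z′` have representatives, and the other `t` - 2 vertices have room
  -- for `s`.
  blue-berge : HasBergeK 4 t c false s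
  blue-berge
    with φ , mono , avoids ← avoiding-two s+2≤t z z′ z≢z′
       | f , pos , inj ← WeightedMatching.matching _≟ᴾ_ _≟ˢ_ (subsets t) (subsets-unique t) w 6 (s≤s z≤n)
                           ⊥ corePairs-unique rows cols =
    berge c mono f (λ u<v → wt-pos (edge? c false _ _) (full? _) (pos (core∈ u<v)))
      (λ u<v u′<v′ → inj (core∈ u<v) (core∈ u′<v′))
    where
    core∈ : ∀ {u v} → u Fin.< v → (φ u , φ v) ∈ corePairs
    core∈ {u} {v} u<v = ∈-filter⁺ core? (∈-sortedPairs⁺ (mono u<v)) (avoids u , avoids v)

-- The red clique

module Red {t : ℕ} (c : Colouring t) (30≤t : 30 ≤ t)
  (blocked : ∀ {z z′} → z ≢ z′ → ∃ λ a → ∃ λ b → Low c false (a , b) × Quad c true a b z z′)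
  {a₀ b₀ a₁ b₁ : Fin t} (distinct : Unique (a₀ ∷ b₀ ∷ a₁ ∷ b₁ ∷ []))
  (low₀ : Low c false (a₀ , b₀)) (low₁ : Low c false (a₁ , b₁)) where

  open import Data.List.Membership.DecPropositional (Fin._≟_ {t}) using (_∈?_)
  open import Data.List.Relation.Unary.Unique.DecPropositional (Fin._≟_ {t}) using (unique?)

  14≤t : 14 ≤ t
  14≤t = ≤-trans (m≤m+n 14 16) 30≤t

  -- The pair `x`, `y` is sorted so that it indexes a row. The colour of `e` is left to `Edge`,
  -- which enters the weight `w` separately.
  record Special (a b x y : Fin t) (e : Subset t) : Set where
    constructor special
    field
      low-blue : Low c false (a , b)
      low-red  : Low c true (x , y)
      sorted   : x Fin.< y
      uniq     : Unique (a ∷ b ∷ x ∷ y ∷ [])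
      e≡       : e ≡ fromList (a ∷ b ∷ x ∷ y ∷ [])

  special? : ∀ a b x y e → Dec (Special a b x y e)
  special? a b x y e = map′ (λ { (p , q , r , s , t) → special p q r s t }) (λ { (special p q r s t) → p , q , r , s , t })
    (low? c false (a , b) ×-dec low? c true (x , y) ×-dec (x Fin.<? y) ×-dec unique? (a ∷ b ∷ x ∷ y ∷ []) ×-dec
     (e ≟ˢ fromList (a ∷ b ∷ x ∷ y ∷ [])))

  -- Such a pair cannot draw half of its weight from each of `a₀b₀xy` and `a₁b₁xy`, since at least
  -- one of them is blue.
  Exceptional : Pair t → Set
  Exceptional (x , y) = Quad c false a₀ b₀ x y ⊎ Quad c false a₁ b₁ x y

  exceptional? : Decidable Exceptional
  exceptional? (x , y) = quad? c false a₀ b₀ x y ⊎-dec quad? c false a₁ b₁ x y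

  -- A poor hyperedge is reserved for its exceptional red-low pair and gives nothing to other pairs.
  IsSpecial IsPoor : Subset t → Set
  IsSpecial e = ∃ λ a → ∃ λ b → ∃ λ x → ∃ λ y → Special a b x y e
  IsPoor    e = ∃ λ a → ∃ λ b → ∃ λ x → ∃ λ y → Special a b x y e × Exceptional (x , y)

  isSpecial? : Decidable IsSpecial
  isSpecial? e = Fin.any? λ a → Fin.any? λ b → Fin.any? λ x → Fin.any? λ y → special? a b x y e

  isPoor? : Decidable IsPoor
  isPoor? e = Fin.any? λ a → Fin.any? λ b → Fin.any? λ x → Fin.any? λ y →
    special? a b x y e ×-dec exceptional? (x , y)

  low-∉ : ∀ {a b x y e u v} → Special a b x y e → Low c true (u , v) → (u ∉ a ∷ b ∷ []) × (v ∉ a ∷ b ∷ [])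
  low-∉ S low with (a≢b ∷ _) ∷ _ ← Special.uniq S = low-disjoint c 14≤t a≢b (Special.low-blue S) low

  -- A red-low pair cannot meet the blue-low pair `a`, `b`, so inside `e` only `x` and `y` remain
  -- for it.
  special-low-pair : ∀ {a b x y e u v} → Special a b x y e → u Fin.< v → Low c true (u , v) →
                     u ∈ˢ e → v ∈ˢ e → (u , v) ≡ (x , y)
  special-low-pair S@(special _ _ x<y _ refl) u<v low u∈ v∈ =
    sorted-unique u<v x<y (in-last-two u∈ (proj₁ (low-∉ S low))) (in-last-two v∈ (proj₂ (low-∉ S low)))

  -- The weight given by a hyperedge to a pair, according to whether the pair is in the red
  -- hyperedge (E), the hyperedge is special (S) and poor (P), and the pair is red-low (L).
  wt : {E S P L : Set} → Dec E → Dec S → Dec P → Dec L → ℕ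
  wt (no  _) _       _       _       = 0
  wt (yes _) (no  _) _       _       = 2
  wt (yes _) (yes _) (yes _) (yes _) = 12
  wt (yes _) (yes _) (yes _) (no  _) = 0
  wt (yes _) (yes _) (no  _) (yes _) = 6
  wt (yes _) (yes _) (no  _) (no  _) = 1

  w : Pair t → Subset t → ℕ
  w q e = wt (edge? c true q e) (isSpecial? e) (isPoor? e) (low? c true q)

  module _ {E S P L : Set} where

    wt-pos : (E? : Dec E) (S? : Dec S) (P? : Dec P) (L? : Dec L) → 0 < wt E? S? P? L? → E
    wt-pos (yes e) _ _ _ _ = e

    wt≤12 : (E? : Dec E) (S? : Dec S) (P? : Dec P) (L? : Dec L) → wt E? S? P? L? ≤ 12
    wt≤12 (no  _) _       _       _       = z≤n
    wt≤12 (yes _) (no  _) _       _       = m≤m+n 2 10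
    wt≤12 (yes _) (yes _) (yes _) (yes _) = ≤-refl
    wt≤12 (yes _) (yes _) (yes _) (no  _) = z≤n
    wt≤12 (yes _) (yes _) (no  _) (yes _) = m≤m+n 6 6
    wt≤12 (yes _) (yes _) (no  _) (no  _) = m≤m+n 1 11

    wt-poor-pos : (E? : Dec E) (s : S) (p : P) (L? : Dec L) → 0 < wt E? (yes s) (yes p) L? → E × L
    wt-poor-pos (yes e) s p (yes l) _ = e , l

    wt-ordinary-≤ : ∀ {Q : Set} (E? : Dec E) (¬s : ¬ S) (P? : Dec P) (L? : Dec L) (Q? : Dec Q) → (E → Q) →
                    wt E? (no ¬s) P? L? ≤ 2 * 𝟙 Q?
    wt-ordinary-≤ (no  _) ¬s P? L? Q? i = z≤n
    wt-ordinary-≤ (yes e) ¬s P? L? Q? i = *-monoʳ-≤ 2 (𝟙-yes Q? (i e))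

    -- The weight 6 of a red-low pair is split as 1 + 5: the 1 is common to all pairs, the 5 is a
    -- surplus paid to at most one pair.
    wt-rich-≤ : ∀ {Q : Set} (E? : Dec E) (s : S) (¬p : ¬ P) (L? : Dec L) (Q? : Dec Q) → (E → Q) →
                wt E? (yes s) (no ¬p) L? ≤ 𝟙 Q? + 5 * 𝟙 (E? ×-dec L?)
    wt-rich-≤ (no  _) s ¬p L?      Q? i = z≤n
    wt-rich-≤ (yes e) s ¬p (yes _) Q? i = +-monoˡ-≤ 5 (𝟙-yes Q? (i e))
    wt-rich-≤ (yes e) s ¬p (no  _) Q? i = ≤-trans (𝟙-yes Q? (i e)) (m≤m+n _ _)

    wt-poor-low : (E? : Dec E) (S? : Dec S) (P? : Dec P) (L? : Dec L) → E → S → P → L → 12 ≤ wt E? S? P? L?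
    wt-poor-low (no ¬e) _       _       _       e s p l = contradiction e ¬e
    wt-poor-low (yes _) (no ¬s) _       _       e s p l = contradiction s ¬s
    wt-poor-low (yes _) (yes _) (no ¬p) _       e s p l = contradiction p ¬p
    wt-poor-low (yes _) (yes _) (yes _) (no ¬l) e s p l = contradiction l ¬l
    wt-poor-low (yes _) (yes _) (yes _) (yes _) e s p l = ≤-refl

    wt-special-low : (E? : Dec E) (S? : Dec S) (P? : Dec P) (L? : Dec L) → E → S → L → 6 ≤ wt E? S? P? L?
    wt-special-low (no ¬e) _       _       _       e s l = contradiction e ¬e
    wt-special-low (yes _) (no ¬s) _       _       e s l = contradiction s ¬s
    wt-special-low (yes _) (yes _) _       (no ¬l) e s l = contradiction l ¬l
    wt-special-low (yes _) (yes _) (no  _) (yes _) e s l = ≤-refl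
    wt-special-low (yes _) (yes _) (yes _) (yes _) e s l = m≤m+n 6 6

    wt-not-poor : (E? : Dec E) (S? : Dec S) (P? : Dec P) (L? : Dec L) → E → ¬ P → 0 < wt E? S? P? L?
    wt-not-poor (no ¬e) _       _       _       e ¬p = contradiction e ¬e
    wt-not-poor (yes _) (no  _) _       _       e ¬p = s≤s z≤n
    wt-not-poor (yes _) (yes _) (yes p) _       e ¬p = contradiction p ¬p
    wt-not-poor (yes _) (yes _) (no  _) (yes _) e ¬p = s≤s z≤n
    wt-not-poor (yes _) (yes _) (no  _) (no  _) e ¬p = ≤-refl

    wt-ordinary-≥ : (E? : Dec E) (S? : Dec S) (P? : Dec P) (L? : Dec L) → (E → ¬ S) → 2 * 𝟙 E? ≤ wt E? S? P? L?
    wt-ordinary-≥ (no  _) _       _ _ i = z≤n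
    wt-ordinary-≥ (yes e) (yes s) _ _ i = contradiction s (i e)
    wt-ordinary-≥ (yes e) (no  _) _ _ i = ≤-refl

  -- A 4-set has six pairs, and a special one contains at most one red-low pair. So the total is at
  -- most 6 · 2 if `e` is not special, 12 if it is poor, and 6 + 5 if it is special but not poor.
  cols : ∀ e → ∑ (sortedPairs t) (λ q → w q e) ≤ 12
  cols e = go (∣ e ∣ ≟ 4) (isSpecial? e) (isPoor? e)
    where
    within : ∀ {q} → q ∈ sortedPairs t → Edge c true q e → Within e q
    within q∈ E = ∈-sortedPairs⁻ q∈ , Edge.left E , Edge.right E
    same : ∀ {q q′} → IsSpecial e → q ∈ sortedPairs t → q′ ∈ sortedPairs t →
           Edge c true q e × Low c true q → Edge c true q′ e × Low c true q′ → q ≡ q′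
    same (_ , _ , _ , _ , S) q∈ q′∈ (E , low) (E′ , low′) =
      trans (special-low-pair S (∈-sortedPairs⁻ q∈) low (Edge.left E) (Edge.right E))
       (sym (special-low-pair S (∈-sortedPairs⁻ q′∈) low′ (Edge.left E′) (Edge.right E′)))
    go : Dec (∣ e ∣ ≡ 4) → (S? : Dec (IsSpecial e)) (P? : Dec (IsPoor e)) →
         ∑ (sortedPairs t) (λ q → wt (edge? c true q e) S? P? (low? c true q)) ≤ 12
    go (no ≢4) S? P? = ∑-at-most-one (sortedPairs-unique t) (λ q → wt≤12 (edge? c true q e) S? P? (low? c true q))
      λ {q} _ _ p → contradiction (Edge.card (wt-pos (edge? c true q e) S? P? (low? c true q) p)) ≢4
    go (yes ≡4) (no ¬s) P? = begin
      ∑ (sortedPairs t) (λ q → wt (edge? c true q e) (no ¬s) P? (low? c true q))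
        ≤⟨ ∑-mono (sortedPairs t) (λ {q} q∈ →
             wt-ordinary-≤ (edge? c true q e) ¬s P? (low? c true q) (within? e q) (within q∈)) ⟩
      ∑ (sortedPairs t) (λ q → 2 * 𝟙 (within? e q))
        ≡⟨ ∑-* (sortedPairs t) 2 _ ⟩
      2 * ∑ (sortedPairs t) (λ q → 𝟙 (within? e q))
        ≤⟨ *-monoʳ-≤ 2 (pairs-within-4-set (sortedPairs-unique t) ≡4) ⟩
      12 ∎
      where open ≤-Reasoning
    go (yes ≡4) (yes s) (yes p) =
      ∑-at-most-one (sortedPairs-unique t) (λ q → wt≤12 (edge? c true q e) (yes s) (yes p) (low? c true q))
        λ {q} {q′} q∈ q′∈ pos pos′ → same s q∈ q′∈ (wt-poor-pos (edge? c true q e) s p (low? c true q) pos)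
                                                   (wt-poor-pos (edge? c true q′ e) s p (low? c true q′) pos′)
    go (yes ≡4) (yes s) (no ¬p) = begin
      ∑ (sortedPairs t) (λ q → wt (edge? c true q e) (yes s) (no ¬p) (low? c true q))
        ≤⟨ ∑-mono (sortedPairs t) (λ {q} q∈ →
             wt-rich-≤ (edge? c true q e) s ¬p (low? c true q) (within? e q) (within q∈)) ⟩
      ∑ (sortedPairs t) (λ q → 𝟙 (within? e q) + 5 * 𝟙 (lowEdge? q))
        ≡⟨ ∑-+ (sortedPairs t) _ _ ⟩
      ∑ (sortedPairs t) (λ q → 𝟙 (within? e q)) + ∑ (sortedPairs t) (λ q → 5 * 𝟙 (lowEdge? q))
        ≡⟨ cong (∑ (sortedPairs t) (λ q → 𝟙 (within? e q)) +_) (∑-* (sortedPairs t) 5 _) ⟩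
      ∑ (sortedPairs t) (λ q → 𝟙 (within? e q)) + 5 * ∑ (sortedPairs t) (λ q → 𝟙 (lowEdge? q))
        ≤⟨ +-mono-≤ (pairs-within-4-set (sortedPairs-unique t) ≡4)
             (*-monoʳ-≤ 5 (∑-at-most-one (sortedPairs-unique t) (λ q → 𝟙≤1 (lowEdge? q))
               λ {q} {q′} q∈ q′∈ pos pos′ → same s q∈ q′∈ (𝟙-pos (lowEdge? q) pos) (𝟙-pos (lowEdge? q′) pos′))) ⟩
      11
        ≤⟨ n≤1+n 11 ⟩
      12 ∎
      where
      open ≤-Reasoning
      lowEdge? : ∀ q → Dec (Edge c true q e × Low c true q)
      lowEdge? q = edge? c true q e ×-dec low? c true q

  exceptional-swap : ∀ {x y} → Exceptional (x , y) → Exceptional (y , x)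
  exceptional-swap (inj₁ q) = inj₁ (quad-swap c q)
  exceptional-swap (inj₂ q) = inj₂ (quad-swap c q)

  -- A hyperedge may be special in several ways, but the red-low pair that makes it poor avoids the
  -- blue-low pair `a`, `b`, and so is `x`, `y` in some order.
  poor⇒exceptional : ∀ {a b x y} → Unique (a ∷ b ∷ x ∷ y ∷ []) → Low c false (a , b) →
                     IsPoor (fromList (a ∷ b ∷ x ∷ y ∷ [])) → Exceptional (x , y)
  poor⇒exceptional ((a≢b ∷ _) ∷ _) low (a′ , b′ , x′ , y′ , special _ low′ x′<y′ _ eq , exc)
    with x′∉ , y′∉ ← low-disjoint c 14≤t a≢b low low′
    with in-last-two (subst (x′ ∈ˢ_) (sym eq) (∈-fromList⁺ {xs = a′ ∷ b′ ∷ x′ ∷ y′ ∷ []} (there (there (here refl))))) x′∉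
       | in-last-two (subst (y′ ∈ˢ_) (sym eq) (∈-fromList⁺ {xs = a′ ∷ b′ ∷ x′ ∷ y′ ∷ []} (there (there (there (here refl)))))) y′∉
  ... | here refl         | here refl         = contradiction x′<y′ (Fin.<-irrefl refl)
  ... | here refl         | there (here refl) = exc
  ... | there (here refl) | here refl         = exceptional-swap exc
  ... | there (here refl) | there (here refl) = contradiction x′<y′ (Fin.<-irrefl refl)

  -- Of the t − 3 hyperedges abxy, at most 5 are blue and at most 10 are poor.
  touched : ∀ {a b x u v} → Low c false (a , b) → Unique (a ∷ b ∷ x ∷ []) →
            u ∈ a ∷ b ∷ x ∷ [] → v ∈ a ∷ b ∷ x ∷ [] → 12 ≤ ∑ (subsets t) (w (u , v))
  touched {a} {b} {x} {u} {v} low abx u∈ v∈ =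
    +-cancelˡ-≤ 18 12 _ (≤-trans 30≤t (subst₂ _≤_ length-allFin (cong (18 +_) (+-identityʳ _)) (union-bound (allFin t)
      (((λ y → 𝟙 (y ∈? a ∷ b ∷ x ∷ [])) , 3) ∷ ((λ y → 𝟙 (quad? c false a b x y)) , 5) ∷
       ((λ y → 𝟙 (quad? c false a₀ b₀ x y)) , 5) ∷ ((λ y → 𝟙 (quad? c false a₁ b₁ x y)) , 5) ∷
       ((λ y → 𝟙 (good? y)) , ∑ (subsets t) (w (u , v))) ∷ [])
      (∑-∈-≤ (a ∷ b ∷ x ∷ []) ∷
       ≤-trans (quads≤deg c {false} {a} {b} {x} (here refl) (there (here refl))) low ∷
       ≤-trans (quads≤deg c {false} {a₀} {b₀} {x} (here refl) (there (here refl))) low₀ ∷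
       ≤-trans (quads≤deg c {false} {a₁} {b₁} {x} (here refl) (there (here refl))) low₁ ∷
       ∑𝟙-image-≤ good? (λ y → fromList (a ∷ b ∷ x ∷ y ∷ [])) (subsets t) (w (u , v)) (allFin⁺ t)
         (λ ((uniq , _) , _) _ → quad-last-injective uniq) (λ (_ , pos) → ∈-subsets _ , pos) ∷ [])
      cover)))
    where
    Good : Fin t → Set
    Good y = Quad c true a b x y × 0 < w (u , v) (fromList (a ∷ b ∷ x ∷ y ∷ []))
    good? : Decidable Good
    good? y = quad? c true a b x y ×-dec (0 <? w (u , v) (fromList (a ∷ b ∷ x ∷ y ∷ [])))
    cover : ∀ y → Any (λ (f , _) → 0 < f y) _
    cover y with red-or-blue c abx y
    ... | inj₁ y∈          = here (𝟙-yes (y ∈? a ∷ b ∷ x ∷ []) y∈)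
    ... | inj₂ (inj₁ blue) = there (here (𝟙-yes (quad? c false a b x y) blue))
    ... | inj₂ (inj₂ red)  = red-cover (exceptional? (x , y))
      where
      red-cover : Dec (Exceptional (x , y)) → Any (λ (f , _) → 0 < f y) _
      red-cover (yes (inj₁ q)) = there (there (here (𝟙-yes (quad? c false a₀ b₀ x y) q)))
      red-cover (yes (inj₂ q)) = there (there (there (here (𝟙-yes (quad? c false a₁ b₁ x y) q))))
      red-cover (no ¬exc) = there (there (there (there (here (𝟙-yes (good? y) (red ,
        wt-not-poor (edge? c true (u , v) _) (isSpecial? _) (isPoor? _) (low? c true (u , v))
          (quad-edge c red (init-∈ u∈) (init-∈ v∈)) (¬exc ∘ poor⇒exceptional (proj₁ red) low)))))))

  -- A pair that is not exceptional gets at least 6 from each of two special hyperedges; an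
  -- exceptional one gets 12 from a poor hyperedge.
  low-row : ∀ {u v} → u Fin.< v → Low c true (u , v) → 12 ≤ ∑ (subsets t) (w (u , v))
  low-row {u} {v} u<v low = go distinct (exceptional? (u , v))
    where
    q : Pair t
    q = u , v
    quad : Fin t → Fin t → Subset t
    quad a b = fromList (a ∷ b ∷ u ∷ v ∷ [])
    q-edge : ∀ {a b} → Quad c true a b u v → Edge c true q (quad a b)
    q-edge Q = quad-edge c Q (there (there (here refl))) (there (there (there (here refl))))
    q-special : ∀ {a b} → Low c false (a , b) → Quad c true a b u v → Special a b u v (quad a b)
    q-special low′ Q = special low′ low u<v (proj₁ Q) refl
    weight≥6 : ∀ {a b} → Low c false (a , b) → Quad c true a b u v → 6 ≤ w q (quad a b)
    weight≥6 {a} {b} low′ Q = wt-special-low (edge? c true q _) (isSpecial? _) (isPoor? _) (low? c true q)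
      (q-edge Q) (a , b , u , v , q-special low′ Q) low
    -- By `low-disjoint` the four vertices are distinct, so a quadruple that is not blue is red.
    red : ∀ {a b} → a ≢ b → Low c false (a , b) → ¬ Quad c false a b u v → Quad c true a b u v
    red {a} {b} a≢b low′ ¬blue with u∉ , v∉ ← low-disjoint c 14≤t a≢b low′ low
      with red-or-blue c (snoc-unique ((a≢b ∷ []) ∷ [] ∷ []) u∉) v
    ... | inj₁ v∈          = contradiction v∈ λ { (here eq) → v∉ (here eq) ; (there (here eq)) → v∉ (there (here eq))
                                                ; (there (there (here refl))) → Fin.<-irrefl refl u<v }
    ... | inj₂ (inj₁ blue) = contradiction blue ¬blue
    ... | inj₂ (inj₂ Q)    = Q
    go : Unique (a₀ ∷ b₀ ∷ a₁ ∷ b₁ ∷ []) → Dec (Exceptional q) → 12 ≤ ∑ (subsets t) (w q)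
    -- Applied to the pair itself, `blocked` supplies a red special hyperedge, which is poor because
    -- the pair is exceptional.
    go _ (yes exc) with a , b , low′ , Q ← blocked (Fin.<⇒≢ u<v) = ≤-trans
      (wt-poor-low (edge? c true q _) (isSpecial? _) (isPoor? _) (low? c true q) (q-edge Q)
        (a , b , u , v , q-special low′ Q) (a , b , u , v , q-special low′ Q , exc) low)
      (∈⇒≤∑ (w q) (∈-subsets (quad a b)))
    go ((a₀≢b₀ ∷ a₀≢a₁ ∷ a₀≢b₁ ∷ []) ∷ _ ∷ (a₁≢b₁ ∷ []) ∷ _) (no ¬exc) =
      ≤-trans (+-mono-≤ (weight≥6 low₀ Q₀) (+-mono-≤ (weight≥6 low₁ Q₁) z≤n))
        (∑-support-≤ {xs = quad a₀ b₀ ∷ quad a₁ b₁ ∷ []} (subsets t) (w q) ((differ ∷ []) ∷ [] ∷ []) λ _ _ → ∈-subsets _)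
      where
      Q₀ : Quad c true a₀ b₀ u v
      Q₀ = red a₀≢b₀ low₀ (¬exc ∘ inj₁)
      Q₁ : Quad c true a₁ b₁ u v
      Q₁ = red a₁≢b₁ low₁ (¬exc ∘ inj₂)
      -- The vertex `a₀` lies in the first set but not in the second.
      differ : quad a₀ b₀ ≢ quad a₁ b₁
      differ eq with (_ ∷ a₀≢u ∷ a₀≢v ∷ []) ∷ _ ← proj₁ Q₀
        with ∈-fromList⁻ (a₁ ∷ b₁ ∷ u ∷ v ∷ []) (subst (a₀ ∈ˢ_) eq (∈-fromList⁺ {xs = a₀ ∷ b₀ ∷ u ∷ v ∷ []} (here refl)))
      ... | here a₀≡a₁                         = a₀≢a₁ a₀≡a₁
      ... | there (here a₀≡b₁)                 = a₀≢b₁ a₀≡b₁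
      ... | there (there (here a₀≡u))          = a₀≢u a₀≡u
      ... | there (there (there (here a₀≡v)))  = a₀≢v a₀≡v

  -- At least six red hyperedges contain the pair, and each gives it 2 because none is special.
  ordinary-row : ∀ {q} → ¬ Low c true q → (∀ {e} → Edge c true q e → ¬ IsSpecial e) →
                 12 ≤ ∑ (subsets t) (w q)
  ordinary-row {q} ¬low ordinary = begin
    12                                              ≤⟨ *-monoʳ-≤ 2 (≰⇒> ¬low) ⟩
    2 * deg c true q                                ≡⟨ ∑-* (subsets t) 2 _ ⟨
    ∑ (subsets t) (λ e → 2 * 𝟙 (edge? c true q e))
      ≤⟨ ∑-mono (subsets t) (λ {e} _ →
           wt-ordinary-≥ (edge? c true q e) (isSpecial? e) (isPoor? e) (low? c true q) ordinary) ⟩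
    ∑ (subsets t) (w q)                             ∎
    where open ≤-Reasoning

  -- Not being red-low, `(u , v)` differs from `(x , y)`, so it meets `a`, `b` and lies in a triple
  -- formed by `a`, `b` and one of `x`, `y`. Then `touched` applies.
  special-row : ∀ {a b x y e u v} → u Fin.< v → ¬ Low c true (u , v) → Edge c true (u , v) e →
                Special a b x y e → 12 ≤ ∑ (subsets t) (w (u , v))
  special-row {a} {b} {x} {y} {u = u} {v} u<v ¬low E
    (special low-blue low-red x<y ((a≢b ∷ a≢x ∷ a≢y ∷ []) ∷ (b≢x ∷ b≢y ∷ []) ∷ _) refl) =
    go (u ∈? a ∷ b ∷ []) (v ∈? a ∷ b ∷ [])
    where
    third : ∀ {z} → z ∈ x ∷ y ∷ [] → Unique (a ∷ b ∷ z ∷ [])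
    third (here refl)         = (a≢b ∷ a≢x ∷ []) ∷ (b≢x ∷ []) ∷ [] ∷ []
    third (there (here refl)) = (a≢b ∷ a≢y ∷ []) ∷ (b≢y ∷ []) ∷ [] ∷ []
    go : Dec (u ∈ a ∷ b ∷ []) → Dec (v ∈ a ∷ b ∷ []) → 12 ≤ ∑ (subsets t) (w (u , v))
    go (yes u∈) (yes v∈) = touched low-blue (third (here refl)) (∈-++⁺ˡ u∈) (∈-++⁺ˡ v∈)
    go (yes u∈) (no v∉)  =
      touched low-blue (third (in-last-two (Edge.right E) v∉)) (∈-++⁺ˡ u∈) (there (there (here refl)))
    go (no u∉)  (yes v∈) =
      touched low-blue (third (in-last-two (Edge.left E) u∉)) (there (there (here refl))) (∈-++⁺ˡ v∈)
    go (no u∉)  (no v∉)  = contradiction (subst (Low c true) (sym (sorted-unique u<v x<y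
      (in-last-two (Edge.left E) u∉) (in-last-two (Edge.right E) v∉))) low-red) ¬low

  rows : ∀ {q} → q ∈ sortedPairs t → 12 ≤ ∑ (subsets t) (w q)
  rows {q} q∈ = go (low? c true q) (any? (λ e → edge? c true q e ×-dec isSpecial? e) (subsets t))
    where
    go : Dec (Low c true q) → Dec (Any (λ e → Edge c true q e × IsSpecial e) (subsets t)) →
         12 ≤ ∑ (subsets t) (w q)
    go (yes low) _           = low-row (∈-sortedPairs⁻ q∈) low
    go (no ¬low) (no none)   = ordinary-row ¬low λ E S → none (lose (∈-subsets _) (E , S))
    go (no ¬low) (yes found) with e , _ , E , a , b , x , y , S ← find found =
      special-row (∈-sortedPairs⁻ q∈) ¬low E S

  red-berge : HasBergeK 4 t c true t
  red-berge
    with f , pos , inj ← WeightedMatching.matching _≟ᴾ_ _≟ˢ_ (subsets t) (subsets-unique t) w 12 (s≤s z≤n)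
                           ⊥ (sortedPairs-unique t) rows cols =
    berge c id f
      (λ {u} {v} u<v → wt-pos (edge? c true (u , v) _) (isSpecial? _) (isPoor? _) (low? c true (u , v)) (pos (∈-sortedPairs⁺ u<v)))
      (λ u<v u′<v′ → inj (∈-sortedPairs⁺ u<v) (∈-sortedPairs⁺ u′<v′))

-- The Ramsey number

arrows : ∀ {s t} → s + 2 ≤ t → 30 ≤ t → Arrows 4 t t s
-- The bound 30 comes from `touched`: 3 vertices of a triple, three sets of at most 5 excluded
-- vertices, and the weight 12 that has to remain.
arrows {s} {t} s+2≤t 30≤t c = go (Fin.any? λ z → Fin.any? λ z′ → ¬? (z Fin.≟ z′) ×-dec ¬? (blocking? z z′))
  where
  Blocking : Fin t → Fin t → Set
  Blocking z z′ = ∃ λ a → ∃ λ b → Low c false (a , b) × Quad c true a b z z′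
  blocking? : ∀ z z′ → Dec (Blocking z z′)
  blocking? z z′ = Fin.any? λ a → Fin.any? λ b → low? c false (a , b) ×-dec quad? c true a b z z′
  red : (∀ {z z′} → z ≢ z′ → Blocking z z′) → HasBergeK 4 t c true t
  red blocked
    with z , _ ← fresh [] (≤-trans (s≤s z≤n) 30≤t)
    with z′ , z′∉ ← fresh [ z ] (≤-trans (s≤s (s≤s z≤n)) 30≤t)
    with a₁ , b₁ , low₁ , (a₁≢b₁ ∷ _) ∷ _ , _ ← blocked {z} {z′} (λ eq → z′∉ (here (sym eq)))
    -- Blocking the pair `a₁`, `b₁` itself yields a second blue-low pair disjoint from it.
    with a₀ , b₀ , low₀ , distinct , _ ← blocked a₁≢b₁ =
    Red.red-berge c 30≤t blocked distinct low₀ low₁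
  go : Dec (∃ λ z → ∃ λ z′ → z ≢ z′ × ¬ Blocking z z′) → HasBergeK 4 t c true t ⊎ HasBergeK 4 t c false s
  go (yes (z , z′ , z≢z′ , unblocked)) = inj₂ (Blue.blue-berge c s+2≤t z≢z′ unblocked)
  go (no none) = inj₁ (red λ {z} {z′} z≢z′ →
    decidable-stable (blocking? z z′) λ ¬blocking → none (z , z′ , z≢z′ , ¬blocking))

-- With every hyperedge red, fewer than `t` vertices leave no room for the red clique, and a blue
-- clique on at least two vertices would need a blue hyperedge.
not-arrows : ∀ {s t N} → 2 ≤ s → N < t → ¬ Arrows 4 N t s
not-arrows (s≤s (s≤s _)) N<t arrow with arrow (λ _ → true)
... | inj₁ (φ , φ-injective , _)      = contradiction (Fin.injective⇒≤ φ-injective) (<⇒≱ N<t)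
... | inj₂ (φ , _ , ψ , edges , _)    with _ , () , _ ← edges zero (suc zero) (s≤s z≤n)

theorem2p12 : (s t : ℕ) → 2 ≤ s → s + 2 ≤ t → 34 ≤ t →
    RamseyBergeEq 4 t s t
theorem2p12 s t 2≤s s+2≤t 34≤t = arrows s+2≤t (≤-trans (m≤m+n 30 4) 34≤t) , λ N → not-arrows 2≤s
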